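{- Let $n$ be a positive integer and let $X \in \mathbb{R}^{n \times n}$ be any matrix of rank $2$. Let $X_{n-1}, X_n \in \mathbb{R}^{n \times n}$ be the matrices with entries \[ X_{n-1}(i,j) = X(i,j)^{n-1} \quad\text{and}\quad X_n(i,j) = X(i,j)^n \] for all $1 \le i,j \le n$. Then \[ (n!)^2 \det[X_n] = n^n \, \det[X_{n-1}] \, \mathrm{per}[X]. \]
   Context: For an $n \times n$ matrix $B$, $\mathrm{per}[B] = \sum_{\sigma \in S_n} \prod_{i=1}^n B(i,\sigma(i))$ denotes the permanent, and $\det$ denotes the usual determinant. The matrices $X_{n-1}$ and $X_n$ are entrywise (Hadamard) powers of $X$, not matrix powers. -}

module Defs where

open import Algebra.Bundles using (CommutativeRing; Semiring)
open import Algebra.Structures using (IsCommutativeRing)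
open import Data.Bool.Base using (if_then_else_)
open import Data.Fin.Base using (Fin; zero; suc; punchIn)
import Data.Fin.Properties as Fin
open import Data.Fin.Permutation as Perm
  using (Permutation′; _⟨$⟩ʳ_; insert; remove; insert-remove)
open import Data.List.Base as List using (List; []; _∷_; allFin; cartesianProductWith)
open import Data.List.Membership.Propositional using (_∈_)
open import Data.List.Membership.Propositional.Properties
  using (∈-allFin; ∈-cartesianProductWith⁺; ∈-cartesianProductWith⁻)
open import Data.List.Relation.Unary.All as All using (All; []; _∷_)
import Data.List.Relation.Unary.All.Properties as All
open import Data.List.Relation.Unary.AllPairs as AllPairs using (AllPairs; []; _∷_)
import Data.List.Relation.Unary.AllPairs.Properties as AllPairs
open import Data.List.Relation.Unary.Any using (here)
open import Data.List.Relation.Unary.Unique.Propositional using (Unique)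
open import Data.List.Relation.Unary.Unique.Propositional.Properties using (allFin⁺)
open import Data.Nat.Base as ℕ using (ℕ; zero; suc; _⊔_)
import Data.Nat.Properties as ℕ
open import Data.Product.Base using (∃; ∃-syntax; _×_; _,_; proj₁; proj₂)
open import Data.Rational.Base as ℚ using (ℚ; 0ℚ; 1ℚ; ½; ∣_∣)
import Data.Rational.Properties as ℚ
open import Data.Rational.Solver using (module +-*-Solver)
open import Data.Vec.Functional as Vector using (Vector)
open import Level using (0ℓ)
open import Relation.Binary.PropositionalEquality
  using (_≡_; refl; sym; trans; cong; subst)
open import Relation.Nullary using (¬_; does)
open import Relation.Nullary.Decidable using (_×-dec_)

-- The real numbers: Cauchy sequences of rationals, considered equal when
-- their difference tends to 0.

Cauchy : (ℕ → ℚ) → Set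
Cauchy x = ∀ ε → 0ℚ ℚ.< ε →
  ∃[ N ] (∀ m n → N ℕ.≤ m → N ℕ.≤ n → ∣ x m ℚ.- x n ∣ ℚ.< ε)

-- Eta would make conversion checking compare the Cauchy proofs.
record ℝ : Set where
  no-eta-equality
  field
    seq    : ℕ → ℚ
    cauchy : Cauchy seq

open ℝ public

infix 4 _≃_

-- A record, so that x and y can be inferred from x ≃ y.
record _≃_ (x y : ℝ) : Set where
  no-eta-equality; pattern
  constructor mk≃
  field
    close : ∀ ε → 0ℚ ℚ.< ε →
      ∃[ N ] (∀ n → N ℕ.≤ n → ∣ seq x n ℚ.- seq y n ∣ ℚ.< ε)

open _≃_ public

private
  half+half : ∀ ε → ε ℚ.* ½ ℚ.+ ε ℚ.* ½ ≡ ε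
  half+half ε = trans (sym (ℚ.*-distribˡ-+ ε ½ ½)) (ℚ.*-identityʳ ε)

  0<half : ∀ {ε} → 0ℚ ℚ.< ε → 0ℚ ℚ.< ε ℚ.* ½
  0<half {ε} 0<ε = subst (ℚ._< ε ℚ.* ½) (ℚ.*-zeroˡ ½) (ℚ.*-monoˡ-<-pos ½ 0<ε)

  ∣-∣-sym : ∀ p q → ∣ p ℚ.- q ∣ ≡ ∣ q ℚ.- p ∣
  ∣-∣-sym p q = trans (sym (ℚ.∣-p∣≡∣p∣ (p ℚ.- q)))
    (cong ∣_∣ (solve 2 (λ p q → :- (p :- q) := q :- p) refl p q))
    where
    open +-*-Solver

  self-close : ∀ {p q ε} → p ≡ q → 0ℚ ℚ.< ε → ∣ p ℚ.- q ∣ ℚ.< ε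
  self-close {p} {ε = ε} refl 0<ε =
    subst (ℚ._< ε) (cong ∣_∣ (sym (ℚ.+-inverseʳ p))) 0<ε

  +-close : ∀ {a b c d ε} → ∣ a ℚ.- c ∣ ℚ.< ε ℚ.* ½ → ∣ b ℚ.- d ∣ ℚ.< ε ℚ.* ½ →
            ∣ (a ℚ.+ b) ℚ.- (c ℚ.+ d) ∣ ℚ.< ε
  +-close {a} {b} {c} {d} {ε} p q = begin-strict
    ∣ (a ℚ.+ b) ℚ.- (c ℚ.+ d) ∣      ≡⟨ cong ∣_∣ (solve 4 (λ a b c d →
                                          (a :+ b) :- (c :+ d) := (a :- c) :+ (b :- d)) refl a b c d) ⟩
    ∣ (a ℚ.- c) ℚ.+ (b ℚ.- d) ∣      ≤⟨ ℚ.∣p+q∣≤∣p∣+∣q∣ (a ℚ.- c) (b ℚ.- d) ⟩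
    ∣ a ℚ.- c ∣ ℚ.+ ∣ b ℚ.- d ∣      <⟨ ℚ.+-mono-< p q ⟩
    ε ℚ.* ½ ℚ.+ ε ℚ.* ½              ≡⟨ half+half ε ⟩
    ε                                ∎
    where
    open ℚ.≤-Reasoning
    open +-*-Solver

  trans-close : ∀ {a b c ε} → ∣ a ℚ.- b ∣ ℚ.< ε ℚ.* ½ → ∣ b ℚ.- c ∣ ℚ.< ε ℚ.* ½ →
                ∣ a ℚ.- c ∣ ℚ.< ε
  trans-close {a} {b} {c} {ε} p q =
    subst (λ z → ∣ z ∣ ℚ.< ε)
      (solve 3 (λ a b c → (a :+ b) :- (b :+ c) := a :- c) refl a b c)
      (+-close {a} {b} {b} {c} p q)
    where
    open +-*-Solver

  neg-close : ∀ {a b ε} → ∣ a ℚ.- b ∣ ℚ.< ε → ∣ (ℚ.- a) ℚ.- (ℚ.- b) ∣ ℚ.< ε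
  neg-close {a} {b} {ε} = subst (ℚ._< ε) (trans (∣-∣-sym a b)
    (cong ∣_∣ (solve 2 (λ a b → b :- a := (:- a) :- (:- b)) refl a b)))
    where
    open +-*-Solver

  -- The tolerance on the factors that yields tolerance ε on a product,
  -- the factors being bounded by A and D.
  splitting : ∀ {A D ε} → 0ℚ ℚ.< A → 0ℚ ℚ.< D → 0ℚ ℚ.< ε →
              ∃[ δ ] (0ℚ ℚ.< δ) × (A ℚ.* δ ℚ.+ D ℚ.* δ ≡ ε)
  splitting {A} {D} {ε} 0<A 0<D 0<ε = δ , 0<δ , eq
    where
    instance
      S-pos : ℚ.Positive (A ℚ.+ D)
      S-pos = ℚ.positive (ℚ.+-mono-< 0<A 0<D)
      S-nz : ℚ.NonZero (A ℚ.+ D)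
      S-nz = ℚ.pos⇒nonZero (A ℚ.+ D)
      S⁻¹-pos : ℚ.Positive (ℚ.1/ (A ℚ.+ D))
      S⁻¹-pos = ℚ.1/pos⇒pos (A ℚ.+ D)
    δ : ℚ
    δ = ε ℚ.* ℚ.1/ (A ℚ.+ D)
    0<δ : 0ℚ ℚ.< δ
    0<δ = subst (ℚ._< δ) (ℚ.*-zeroˡ (ℚ.1/ (A ℚ.+ D))) (ℚ.*-monoˡ-<-pos (ℚ.1/ (A ℚ.+ D)) 0<ε)
    eq : A ℚ.* δ ℚ.+ D ℚ.* δ ≡ ε
    eq = trans (solve 4 (λ A D ε i → A :* (ε :* i) :+ D :* (ε :* i) := ε :* ((A :+ D) :* i))
                 refl A D ε (ℚ.1/ (A ℚ.+ D)))
         (trans (cong (ε ℚ.*_) (ℚ.*-inverseʳ (A ℚ.+ D))) (ℚ.*-identityʳ ε))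
      where
      open +-*-Solver

  scaled-close : ∀ {a b A δ} → ∣ a ∣ ℚ.< A → ∣ b ∣ ℚ.< δ → 0ℚ ℚ.< δ →
                 ∣ a ℚ.* b ∣ ℚ.< A ℚ.* δ
  scaled-close {a} {b} {A} {δ} p q 0<δ = begin-strict
    ∣ a ℚ.* b ∣        ≡⟨ ℚ.∣p*q∣≡∣p∣*∣q∣ a b ⟩
    ∣ a ∣ ℚ.* ∣ b ∣    ≤⟨ ℚ.*-monoˡ-≤-nonNeg ∣ a ∣ {{ℚ.∣-∣-nonNeg a}} (ℚ.<⇒≤ q) ⟩
    ∣ a ∣ ℚ.* δ        <⟨ ℚ.*-monoˡ-<-pos δ {{ℚ.positive 0<δ}} p ⟩
    A ℚ.* δ            ∎
    where
    open ℚ.≤-Reasoning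

  *-close : ∀ {a b c d A D δ ε} → A ℚ.* δ ℚ.+ D ℚ.* δ ≡ ε → 0ℚ ℚ.< δ →
            ∣ a ∣ ℚ.< A → ∣ d ∣ ℚ.< D → ∣ a ℚ.- c ∣ ℚ.< δ → ∣ b ℚ.- d ∣ ℚ.< δ →
            ∣ (a ℚ.* b) ℚ.- (c ℚ.* d) ∣ ℚ.< ε
  *-close {a} {b} {c} {d} {A} {D} {δ} {ε} eq 0<δ a<A d<D p q = begin-strict
    ∣ (a ℚ.* b) ℚ.- (c ℚ.* d) ∣                        ≡⟨ cong ∣_∣ (solve 4 (λ a b c d →
                                                            (a :* b) :- (c :* d) := a :* (b :- d) :+ d :* (a :- c)) refl a b c d) ⟩
    ∣ a ℚ.* (b ℚ.- d) ℚ.+ d ℚ.* (a ℚ.- c) ∣            ≤⟨ ℚ.∣p+q∣≤∣p∣+∣q∣ (a ℚ.* (b ℚ.- d)) (d ℚ.* (a ℚ.- c)) ⟩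
    ∣ a ℚ.* (b ℚ.- d) ∣ ℚ.+ ∣ d ℚ.* (a ℚ.- c) ∣        <⟨ ℚ.+-mono-< (scaled-close a<A q 0<δ) (scaled-close d<D p 0<δ) ⟩
    A ℚ.* δ ℚ.+ D ℚ.* δ                                ≡⟨ eq ⟩
    ε                                                  ∎
    where
    open ℚ.≤-Reasoning
    open +-*-Solver

  bounded : ∀ x → Cauchy x →
            ∃[ B ] (0ℚ ℚ.< B) × (∃[ N ] (∀ n → N ℕ.≤ n → ∣ x n ∣ ℚ.< B))
  bounded x cx with cx 1ℚ (ℚ.positive⁻¹ 1ℚ)
  ... | N , close = B , 0<B , N , below
    where
    B : ℚ
    B = 1ℚ ℚ.+ ∣ x N ∣
    0<B : 0ℚ ℚ.< B
    0<B = ℚ.+-mono-<-≤ (ℚ.positive⁻¹ 1ℚ) (ℚ.0≤∣p∣ (x N))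
    below : ∀ n → N ℕ.≤ n → ∣ x n ∣ ℚ.< B
    below n N≤n = begin-strict
      ∣ x n ∣                              ≡⟨ cong ∣_∣ (solve 2 (λ p q → p := (p :- q) :+ q) refl (x n) (x N)) ⟩
      ∣ (x n ℚ.- x N) ℚ.+ x N ∣            ≤⟨ ℚ.∣p+q∣≤∣p∣+∣q∣ (x n ℚ.- x N) (x N) ⟩
      ∣ x n ℚ.- x N ∣ ℚ.+ ∣ x N ∣          <⟨ ℚ.+-monoˡ-< ∣ x N ∣ (close n N N≤n ℕ.≤-refl) ⟩
      B                                    ∎
      where
      open ℚ.≤-Reasoning
      open +-*-Solver

  left : ∀ {M N n} → M ⊔ N ℕ.≤ n → M ℕ.≤ n
  left {M} {N} = ℕ.m⊔n≤o⇒m≤o M N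

  right : ∀ {M N n} → M ⊔ N ℕ.≤ n → N ℕ.≤ n
  right {M} {N} = ℕ.m⊔n≤o⇒n≤o M N

infixl 6 _+ᴿ_
infixl 7 _*ᴿ_
infix  8 -ᴿ_

_+ᴿ_ : ℝ → ℝ → ℝ
seq    (x +ᴿ y) n = seq x n ℚ.+ seq y n
cauchy (x +ᴿ y) ε 0<ε with cauchy x (ε ℚ.* ½) (0<half 0<ε) | cauchy y (ε ℚ.* ½) (0<half 0<ε)
... | M , p | N , q = M ⊔ N , λ m n l r →
  +-close {seq x m} {seq y m} {seq x n} {seq y n} (p m n (left {M} {N} l) (left {M} {N} r)) (q m n (right {M} {N} l) (right {M} {N} r))

_*ᴿ_ : ℝ → ℝ → ℝ
seq    (x *ᴿ y) n = seq x n ℚ.* seq y n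
cauchy (x *ᴿ y) ε 0<ε =
  let A , 0<A , K , x<A = bounded (seq x) (cauchy x)
      D , 0<D , L , y<D = bounded (seq y) (cauchy y)
      δ , 0<δ , eq = splitting {A} {D} {ε} 0<A 0<D 0<ε
      M , p = cauchy x δ 0<δ
      N , q = cauchy y δ 0<δ
  in (K ⊔ L) ⊔ (M ⊔ N) , λ m n l r →
    *-close {seq x m} {seq y m} {seq x n} {seq y n} {A} {D} {δ} {ε} eq 0<δ
      (x<A m (left {K} {L} (left {K ⊔ L} {M ⊔ N} l))) (y<D n (right {K} {L} (left {K ⊔ L} {M ⊔ N} r)))
      (p m n (left {M} {N} (right {K ⊔ L} {M ⊔ N} l)) (left {M} {N} (right {K ⊔ L} {M ⊔ N} r)))
      (q m n (right {M} {N} (right {K ⊔ L} {M ⊔ N} l)) (right {M} {N} (right {K ⊔ L} {M ⊔ N} r)))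

-ᴿ_ : ℝ → ℝ
seq    (-ᴿ x) n = ℚ.- seq x n
cauchy (-ᴿ x) ε 0<ε with cauchy x ε 0<ε
... | N , p = N , λ m n l r → neg-close {seq x m} {seq x n} (p m n l r)

fromℚ : ℚ → ℝ
seq    (fromℚ q) n = q
cauchy (fromℚ q) ε 0<ε = 0 , λ _ _ _ _ → self-close {q} refl 0<ε

0ᴿ 1ᴿ : ℝ
0ᴿ = fromℚ 0ℚ
1ᴿ = fromℚ 1ℚ

private
  pointwise : ∀ {x y} → (∀ n → seq x n ≡ seq y n) → x ≃ y
  pointwise eq = mk≃ λ ε 0<ε → 0 , λ n _ → self-close (eq n) 0<ε

  ≃-sym : ∀ {x y} → x ≃ y → y ≃ x
  ≃-sym {x} {y} (mk≃ p) = mk≃ λ ε 0<ε → let N , h = p ε 0<ε in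
    N , λ n l → subst (ℚ._< ε) (∣-∣-sym (seq x n) (seq y n)) (h n l)

  ≃-trans : ∀ {x y z} → x ≃ y → y ≃ z → x ≃ z
  ≃-trans {x} {y} {z} (mk≃ p) (mk≃ q) = mk≃ λ ε 0<ε →
    let M , h = p (ε ℚ.* ½) (0<half 0<ε)
        N , k = q (ε ℚ.* ½) (0<half 0<ε)
    in M ⊔ N , λ n l →
      trans-close {seq x n} {seq y n} {seq z n} (h n (left {M} {N} l)) (k n (right {M} {N} l))

  +ᴿ-cong : ∀ {x y u v} → x ≃ y → u ≃ v → x +ᴿ u ≃ y +ᴿ v
  +ᴿ-cong {x} {y} {u} {v} (mk≃ p) (mk≃ q) = mk≃ λ ε 0<ε →
    let M , h = p (ε ℚ.* ½) (0<half 0<ε)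
        N , k = q (ε ℚ.* ½) (0<half 0<ε)
    in M ⊔ N , λ n l →
      +-close {seq x n} {seq u n} {seq y n} {seq v n} (h n (left {M} {N} l)) (k n (right {M} {N} l))

  *ᴿ-cong : ∀ {x y u v} → x ≃ y → u ≃ v → x *ᴿ u ≃ y *ᴿ v
  *ᴿ-cong {x} {y} {u} {v} (mk≃ p) (mk≃ q) = mk≃ λ ε 0<ε →
    let A , 0<A , K , x<A = bounded (seq x) (cauchy x)
        D , 0<D , L , v<D = bounded (seq v) (cauchy v)
        δ , 0<δ , eq = splitting {A} {D} {ε} 0<A 0<D 0<ε
        M , h = p δ 0<δ
        N , k = q δ 0<δ
    in (K ⊔ L) ⊔ (M ⊔ N) , λ n l →
      *-close {seq x n} {seq u n} {seq y n} {seq v n} {A} {D} {δ} {ε} eq 0<δ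
        (x<A n (left {K} {L} (left {K ⊔ L} {M ⊔ N} l))) (v<D n (right {K} {L} (left {K ⊔ L} {M ⊔ N} l)))
        (h n (left {M} {N} (right {K ⊔ L} {M ⊔ N} l))) (k n (right {M} {N} (right {K ⊔ L} {M ⊔ N} l)))

  -ᴿ-cong : ∀ {x y} → x ≃ y → -ᴿ x ≃ -ᴿ y
  -ᴿ-cong {x} {y} (mk≃ p) = mk≃ λ ε 0<ε → let N , h = p ε 0<ε in
    N , λ n l → neg-close {seq x n} {seq y n} (h n l)

  +ᴿ-assoc : ∀ x y z → (x +ᴿ y) +ᴿ z ≃ x +ᴿ (y +ᴿ z)
  +ᴿ-assoc x y z = pointwise λ n → ℚ.+-assoc (seq x n) (seq y n) (seq z n)

  +ᴿ-identityˡ : ∀ x → 0ᴿ +ᴿ x ≃ x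
  +ᴿ-identityˡ x = pointwise λ n → ℚ.+-identityˡ (seq x n)

  +ᴿ-identityʳ : ∀ x → x +ᴿ 0ᴿ ≃ x
  +ᴿ-identityʳ x = pointwise λ n → ℚ.+-identityʳ (seq x n)

  +ᴿ-inverseˡ : ∀ x → (-ᴿ x) +ᴿ x ≃ 0ᴿ
  +ᴿ-inverseˡ x = pointwise λ n → ℚ.+-inverseˡ (seq x n)

  +ᴿ-inverseʳ : ∀ x → x +ᴿ (-ᴿ x) ≃ 0ᴿ
  +ᴿ-inverseʳ x = pointwise λ n → ℚ.+-inverseʳ (seq x n)

  +ᴿ-comm : ∀ x y → x +ᴿ y ≃ y +ᴿ x
  +ᴿ-comm x y = pointwise λ n → ℚ.+-comm (seq x n) (seq y n)

  *ᴿ-assoc : ∀ x y z → (x *ᴿ y) *ᴿ z ≃ x *ᴿ (y *ᴿ z)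
  *ᴿ-assoc x y z = pointwise λ n → ℚ.*-assoc (seq x n) (seq y n) (seq z n)

  *ᴿ-identityˡ : ∀ x → 1ᴿ *ᴿ x ≃ x
  *ᴿ-identityˡ x = pointwise λ n → ℚ.*-identityˡ (seq x n)

  *ᴿ-identityʳ : ∀ x → x *ᴿ 1ᴿ ≃ x
  *ᴿ-identityʳ x = pointwise λ n → ℚ.*-identityʳ (seq x n)

  *ᴿ-distribˡ-+ᴿ : ∀ x y z → x *ᴿ (y +ᴿ z) ≃ (x *ᴿ y) +ᴿ (x *ᴿ z)
  *ᴿ-distribˡ-+ᴿ x y z = pointwise λ n → ℚ.*-distribˡ-+ (seq x n) (seq y n) (seq z n)

  *ᴿ-distribʳ-+ᴿ : ∀ x y z → (y +ᴿ z) *ᴿ x ≃ (y *ᴿ x) +ᴿ (z *ᴿ x)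
  *ᴿ-distribʳ-+ᴿ x y z = pointwise λ n → ℚ.*-distribʳ-+ (seq x n) (seq y n) (seq z n)

  *ᴿ-comm : ∀ x y → x *ᴿ y ≃ y *ᴿ x
  *ᴿ-comm x y = pointwise λ n → ℚ.*-comm (seq x n) (seq y n)

ℝ-isCommutativeRing : IsCommutativeRing _≃_ _+ᴿ_ _*ᴿ_ -ᴿ_ 0ᴿ 1ᴿ
ℝ-isCommutativeRing = record
  { isRing = record
    { +-isAbelianGroup = record
      { isGroup = record
        { isMonoid = record
          { isSemigroup = record
            { isMagma = record
              { isEquivalence = record
                { refl  = pointwise λ _ → refl
                ; sym   = ≃-sym
                ; trans = ≃-trans
                }
              ; ∙-cong = +ᴿ-cong
              }
            ; assoc = +ᴿ-assoc
            }
          ; identity = +ᴿ-identityˡ , +ᴿ-identityʳ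
          }
        ; inverse = +ᴿ-inverseˡ , +ᴿ-inverseʳ
        ; ⁻¹-cong = -ᴿ-cong
        }
      ; comm = +ᴿ-comm
      }
    ; *-cong = *ᴿ-cong
    ; *-assoc = *ᴿ-assoc
    ; *-identity = *ᴿ-identityˡ , *ᴿ-identityʳ
    ; distrib = *ᴿ-distribˡ-+ᴿ , *ᴿ-distribʳ-+ᴿ
    }
  ; *-comm = *ᴿ-comm
  }

ℝ-commutativeRing : CommutativeRing 0ℓ 0ℓ
ℝ-commutativeRing = record { isCommutativeRing = ℝ-isCommutativeRing }

-- The permutations of Fin (suc n) are obtained by choosing the image k of 0
-- and a bijection from the nonzero elements to the elements other than k.
permutations : ∀ n → List (Permutation′ n)
permutations zero    = Perm.id ∷ []
permutations (suc n) = cartesianProductWith (insert zero) (allFin (suc n)) (permutations n)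

private
  insert-cong : ∀ {n} k {π ρ : Permutation′ n} → π Perm.≈ ρ →
                insert zero k π Perm.≈ insert zero k ρ
  insert-cong k π≈ρ zero    = refl
  insert-cong k π≈ρ (suc i) = cong (punchIn k) (π≈ρ i)

  insert-injective : ∀ {n} {k l} {π ρ : Permutation′ n} →
                     insert zero k π Perm.≈ insert zero l ρ → k ≡ l × π Perm.≈ ρ
  insert-injective {k = k} {π = π} {ρ} eq with eq zero
  ... | refl = refl , λ i → Fin.punchIn-injective k (π ⟨$⟩ʳ i) (ρ ⟨$⟩ʳ i) (eq (suc i))

-- Every permutation occurs in the list, and none occurs twice, up to
-- pointwise equality (propositional equality also compares the proofs).
permutations-complete : ∀ {n} (π : Permutation′ n) →
                        ∃[ ρ ] ρ ∈ permutations n × π Perm.≈ ρ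
permutations-complete {zero}  π = Perm.id , here refl , λ ()
permutations-complete {suc n} π with permutations-complete (remove zero π)
... | ρ , ρ∈ , eq =
  insert zero k ρ ,
  ∈-cartesianProductWith⁺ (insert zero) (∈-allFin k) ρ∈ ,
  λ i → trans (sym (insert-remove zero π i)) (insert-cong k {remove zero π} {ρ} eq i)
  where k = π ⟨$⟩ʳ zero

permutations-distinct : ∀ n → AllPairs (λ π ρ → ¬ (π Perm.≈ ρ)) (permutations n)
permutations-distinct zero    = [] ∷ []
permutations-distinct (suc n) = go (allFin⁺ (suc n))
  where
  ps = permutations n
  go : ∀ {ks} → Unique ks →
       AllPairs (λ π ρ → ¬ (π Perm.≈ ρ)) (cartesianProductWith (insert zero) ks ps)
  go {[]}     []         = []
  go {k ∷ ks} (k∉ ∷ uks) = AllPairs.++⁺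
    (AllPairs.map⁺ (AllPairs.map
      (λ {π} {ρ} π≉ρ eq → π≉ρ (proj₂ (insert-injective {π = π} {ρ} eq)))
      (permutations-distinct n)))
    (go uks)
    (All.map⁺ (All.tabulate λ {π} _ → All.tabulate λ ρ∈ eq →
      let l , ρ , l∈ , _ , e = ∈-cartesianProductWith⁻ (insert zero) ks ps ρ∈
      in All.lookup k∉ l∈
           (proj₁ (insert-injective {π = π} {ρ} (subst (insert zero k π Perm.≈_) e eq)))))

inversions : ∀ {n} → Permutation′ n → ℕ
inversions {n} π = sum λ i → sum λ j →
  if does ((i Fin.<? j) ×-dec ((π ⟨$⟩ʳ j) Fin.<? (π ⟨$⟩ʳ i))) then 1 else 0
  where
  sum : Vector ℕ n → ℕ
  sum = Vector.foldr ℕ._+_ 0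

module Matrices {c ℓ} (R : CommutativeRing c ℓ) where

  open CommutativeRing R hiding (refl; sym; trans)
  open import Algebra.Definitions.RawSemiring (Semiring.rawSemiring semiring) public
    using (_^_; sum; product) renaming (_×_ to _·_)

  Matrix : ℕ → ℕ → Set c
  Matrix m n = Fin m → Fin n → Carrier

  sumₛ : ∀ {n} → (Permutation′ n → Carrier) → Carrier
  sumₛ {n} f = List.foldr _+_ 0# (List.map f (permutations n))

  sign : ∀ {n} → Permutation′ n → Carrier
  sign π = (- 1#) ^ inversions π

  det : ∀ {n} → Matrix n n → Carrier
  det B = sumₛ λ σ → sign σ * product λ i → B i (σ ⟨$⟩ʳ i)

  per : ∀ {n} → Matrix n n → Carrier
  per B = sumₛ λ σ → product λ i → B i (σ ⟨$⟩ʳ i)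

  infix 9 _^∘_

  _^∘_ : ∀ {m n} → Matrix m n → ℕ → Matrix m n
  (X ^∘ k) i j = X i j ^ k

  lincomb : ∀ {m r} → Vector Carrier r → Vector (Vector Carrier m) r → Vector Carrier m
  lincomb a v i = sum λ k → a k * v k i

  infix 4 _∈span_

  _∈span_ : ∀ {m r} → Vector Carrier m → Vector (Vector Carrier m) r → Set _
  w ∈span v = ∃[ a ] (∀ i → w i ≈ lincomb a v i)

  LinearlyIndependent : ∀ {m r} → Vector (Vector Carrier m) r → Set _
  LinearlyIndependent v = ∀ a → (∀ i → lincomb a v i ≈ 0#) → ∀ k → a k ≈ 0#

  column : ∀ {m n} → Matrix m n → Vector (Vector Carrier m) n
  column X j i = X i j

  record IsColumnSpaceBasis {m n r} (X : Matrix m n) (v : Vector (Vector Carrier m) r) :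
         Set (c Level.⊔ ℓ) where
    field
      independent : LinearlyIndependent v
      contained   : ∀ k → v k ∈span column X
      spanning    : ∀ w → w ∈span column X → w ∈span v

  -- The column space has dimension r. Independence is in the weak sense: no
  -- apartness is required, which over ℝ is classically the usual notion and
  -- constructively the less demanding hypothesis.
  HasRank : ∀ {m n} → Matrix m n → ℕ → Set (c Level.⊔ ℓ)
  HasRank {m} X r = ∃[ v ] IsColumnSpaceBasis {r = r} X v

open Matrices ℝ-commutativeRing public

module Submission where

-- A matrix of rank 2 is X = Pᵀ Q with P, Q of two rows, so the binomial theorem
-- writes X_N as a product of a matrix in P, a diagonal matrix of binomial
-- coefficients and a matrix in Q. For N = n − 1 this makes det X_N a product of
-- the Vandermonde determinants V(P) V(Q); for N = n the Cauchy–Binet formula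
-- gives ∑ₖ (∏_{l ≠ k} C(n, l)) Vₖ(P) Vₖ(Q), where Vₖ is the determinant of the
-- monomials of degree n without the k-th. On the other side, per L · det B is
-- the sum over σ of the determinants whose i-th row is the entrywise product of
-- row σ i of L and row i of B. If the rows of L are combinations of those of Q
-- and B holds the monomials of degree n − 1, each entrywise product raises one of
-- the two exponents of a row, and only the determinants with distinct exponents,
-- the Vₖ(Q), survive (Pieri's rule). Applied to Q and then to P this gives
-- V(P) V(Q) per X = ∑ₖ k! (n − k)! Vₖ(P) Vₖ(Q), and the coefficients of the two
-- sums over k agree up to the factor in the theorem.

open import Algebra.Bundles using (CommutativeRing)
import Algebra.Properties.CommutativeMonoid.Sum as CommutativeMonoidSum
open import Data.Bool.Base using (if_then_else_; _∧_)
open import Data.Fin.Base using (Fin; zero; suc; toℕ; fromℕ; inject₁; punchIn)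
open import Data.Fin.Patterns using (0F; 1F)
open import Data.Fin.Permutation using (Permutation′; _⟨$⟩ʳ_; insert)
open import Data.Fin.Properties using (punchInᵢ≢i; toℕ-fromℕ; toℕ-inject₁; toℕ≤pred[n])
open import Data.List.Base as List using (List)
import Data.List.Properties as List
open import Data.Nat.Base as ℕ using (zero; suc; _≤_; s≤s; _<ᵇ_)
open import Data.Nat.Combinatorics using (_C_; nCk≡n!/k![n-k]!; k![n∸k]!∣n!)
open import Data.Nat.DivMod using (m/n*n≡m)
import Data.Nat.Properties as ℕ
open import Data.Nat.Solver using (module +-*-Solver)
open import Data.Product.Base using (∃-syntax; _,_; proj₁; proj₂)
open import Data.Vec.Base using (Vec; []; _∷_; lookup; map; tabulate)
open import Data.Vec.Functional using (Vector)
open import Data.Vec.Properties using (lookup∘tabulate; tabulate-cong; tabulate-∘)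
open import Function.Base using (_∘_; id)
open import Level using (Level; _⊔_)
open import Relation.Binary.PropositionalEquality as ≡ using (_≡_; _≢_)
open import Relation.Nullary using (contradiction)

open import Defs using (module Matrices; inversions; permutations)
open import Data.Nat.Base using (ℕ; NonZero; _∸_; _!) renaming (_^_ to _^ℕ_)

-- Positions and words

module ℕ∑ = CommutativeMonoidSum ℕ.+-0-commutativeMonoid
-- `ℕ∏.sum` is the sum of the multiplicative monoid, that is, a product.
module ℕ∏ = CommutativeMonoidSum ℕ.*-1-commutativeMonoid

-- A pair of distinct positions k, k′ is encoded as (k , l) with k′ = punchIn k l;
-- the same pair in the opposite order is (punchIn k l , cross k l).
cross : ∀ {n} → Fin (suc (suc n)) → Fin (suc n) → Fin (suc n)
cross         zero    l       = zero
cross         (suc k) zero    = k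
cross {suc n} (suc k) (suc l) = suc (cross k l)

punchIn-cross : ∀ {n} (k : Fin (suc (suc n))) l → punchIn (punchIn k l) (cross k l) ≡ k
punchIn-cross         zero    l       = ≡.refl
punchIn-cross         (suc k) zero    = ≡.refl
punchIn-cross {suc n} (suc k) (suc l) = ≡.cong suc (punchIn-cross k l)

-- So the minor left by deleting two rows or columns does not depend on the order of deletion.
punchIn-punchIn : ∀ {n} (k : Fin (suc (suc n))) l j →
  punchIn (punchIn k l) (punchIn (cross k l) j) ≡ punchIn k (punchIn l j)
punchIn-punchIn         zero    l       j       = ≡.refl
punchIn-punchIn         (suc k) zero    j       = ≡.refl
punchIn-punchIn {suc n} (suc k) (suc l) zero    = ≡.refl
punchIn-punchIn {suc n} (suc k) (suc l) (suc j) = ≡.cong suc (punchIn-punchIn k l j)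

-- Neighbouring letters suffice for alternation, since adjacent swaps move any letter anywhere, and
-- for determinants they reduce by recursion to the first two rows.
data Swap {i} {I : Set i} : ∀ {n} → Vec I n → Vec I n → Set i where
  here  : ∀ {n x y} {f : Vec I n} → Swap (x ∷ y ∷ f) (y ∷ x ∷ f)
  there : ∀ {n x} {f g : Vec I n} → Swap f g → Swap (x ∷ f) (x ∷ g)

data Stutter {i} {I : Set i} : ∀ {n} → Vec I n → Set i where
  here  : ∀ {n x} {f : Vec I n} → Stutter (x ∷ x ∷ f)
  there : ∀ {n x} {f : Vec I n} → Stutter f → Stutter (x ∷ f)

map-Swap : ∀ {i j} {I : Set i} {J : Set j} (h : I → J) {n} {f g : Vec I n} →
  Swap f g → Swap (map h f) (map h g)
map-Swap h here      = here
map-Swap h (there s) = there (map-Swap h s)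

map-Stutter : ∀ {i j} {I : Set i} {J : Set j} (h : I → J) {n} {f : Vec I n} →
  Stutter f → Stutter (map h f)
map-Stutter h here      = here
map-Stutter h (there s) = there (map-Stutter h s)

-- k zeros followed by ones: these are the words without a `Descent`.
step : ∀ {n} → Fin (suc n) → Fin n → Fin 2
step zero    i       = 1F
step (suc k) zero    = 0F
step (suc k) (suc i) = step k i

-- Raising the exponent i of each row i by `step k i` therefore yields all exponents up to n except
-- k.
step+ : ∀ {n} (k : Fin (suc n)) i → toℕ (step k i) ℕ.+ toℕ i ≡ toℕ (punchIn k i)
step+ zero    i       = ≡.refl
step+ (suc k) zero    = ≡.refl
step+ (suc k) (suc i) = ≡.trans (ℕ.+-suc (toℕ (step k i)) (toℕ i)) (≡.cong suc (step+ k i))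

-- Which of the k + 1 zeros is deleted makes no difference to the word that remains.
step-punchIn : ∀ {n} (k : Fin (suc n)) i → step (suc k) i ≡ 0F →
  ∀ j → step (suc k) (punchIn i j) ≡ step k j
step-punchIn k       zero    eq j       = ≡.refl
step-punchIn (suc k) (suc i) eq zero    = ≡.refl
step-punchIn (suc k) (suc i) eq (suc j) = step-punchIn k i eq j

data Descent : ∀ {n} → Vec (Fin 2) n → Set where
  here  : ∀ {n} {f : Vec (Fin 2) n} → Descent (1F ∷ 0F ∷ f)
  there : ∀ {n x} {f : Vec (Fin 2) n} → Descent f → Descent (x ∷ f)

shift : ∀ {n} → ℕ → Vec (Fin 2) n → Vec ℕ n
shift o []      = []
shift o (s ∷ f) = toℕ s ℕ.+ o ∷ shift (suc o) f

lookup-shift : ∀ {n} o (f : Vec (Fin 2) n) i → lookup (shift o f) i ≡ toℕ (lookup f i) ℕ.+ (o ℕ.+ toℕ i)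
lookup-shift o (s ∷ f) zero    = ≡.cong (toℕ s ℕ.+_) (≡.sym (ℕ.+-identityʳ o))
lookup-shift o (s ∷ f) (suc i) =
  ≡.trans (lookup-shift (suc o) f i) (≡.cong (toℕ (lookup f i) ℕ.+_) (≡.sym (ℕ.+-suc o (toℕ i))))

-- At a descent a row is raised to the exponent that the next row has and keeps.
shift-descent : ∀ {n} o {f : Vec (Fin 2) n} → Descent f → Stutter (shift o f)
shift-descent o here      = here
shift-descent o (there d) = there (shift-descent (suc o) d)

-- Inversions of a permutation

count-below : ∀ {n} (k : Fin (suc n)) →
  ℕ∑.sum (λ m → if toℕ (punchIn k m) <ᵇ toℕ k then 1 else 0) ≡ toℕ k
count-below {n}     zero    = ℕ∑.sum-replicate-zero n
count-below {suc n} (suc k) = ≡.cong suc (count-below k)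

punchIn-<ᵇ : ∀ {n} (k : Fin (suc n)) a b →
  (toℕ (punchIn k a) <ᵇ toℕ (punchIn k b)) ≡ (toℕ a <ᵇ toℕ b)
punchIn-<ᵇ zero    a       b       = ≡.refl
punchIn-<ᵇ (suc k) zero    zero    = ≡.refl
punchIn-<ᵇ (suc k) zero    (suc b) = ≡.refl
punchIn-<ᵇ (suc k) (suc a) zero    = ≡.refl
punchIn-<ᵇ (suc k) (suc a) (suc b) = punchIn-<ᵇ k a b

-- The value k at position 0 forms an inversion with each of the k smaller values, whatever order π
-- puts them in, and `punchIn k` keeps the order of the other values.
inversions-insert : ∀ {n} (k : Fin (suc n)) (π : Permutation′ n) →
  inversions (insert zero k π) ≡ toℕ k ℕ.+ inversions π
inversions-insert k π = ≡.cong₂ ℕ._+_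
  (≡.trans (≡.sym (ℕ∑.sum-permute (λ m → if toℕ (punchIn k m) <ᵇ toℕ k then 1 else 0) π)) (count-below k))
  (ℕ∑.sum-cong-≋ λ i → ℕ∑.sum-cong-≋ λ j →
    ≡.cong (λ b → if (toℕ i <ᵇ toℕ j) ∧ b then 1 else 0) (punchIn-<ᵇ k (π ⟨$⟩ʳ j) (π ⟨$⟩ʳ i)))

-- Products of binomial coefficients

C*k![n∸k]! : ∀ {n k} → k ≤ n → (n C k) ℕ.* (k ! ℕ.* (n ∸ k) !) ≡ n !
C*k![n∸k]! {n} {k} k≤n = ≡.trans
  (≡.cong (ℕ._* (k ! ℕ.* (n ∸ k) !)) (nCk≡n!/k![n-k]! k≤n))
  (m/n*n≡m (k![n∸k]!∣n! k≤n))
  where instance _ = k ℕ.!* (n ∸ k) !≢0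

-- Multiplied by k! (m - k)!, both sides are (m + 1)!.
C-absorb : ∀ {m k} → k ≤ m → (suc m C suc k) ℕ.* suc k ≡ suc m ℕ.* (m C k)
C-absorb {m} {k} k≤m = ℕ.*-cancelʳ-≡ _ _ (k ! ℕ.* (m ∸ k) !) (begin
  (suc m C suc k) ℕ.* suc k ℕ.* (k ! ℕ.* (m ∸ k) !)
    ≡⟨ solve 4 (λ c s f g → c :* s :* (f :* g) := c :* (s :* f :* g)) ≡.refl (suc m C suc k) (suc k) (k !) ((m ∸ k) !) ⟩
  (suc m C suc k) ℕ.* (suc k ! ℕ.* (m ∸ k) !)
    ≡⟨ C*k![n∸k]! (s≤s k≤m) ⟩
  suc m ℕ.* m !
    ≡⟨ ≡.cong (suc m ℕ.*_) (C*k![n∸k]! k≤m) ⟨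
  suc m ℕ.* ((m C k) ℕ.* (k ! ℕ.* (m ∸ k) !))
    ≡⟨ ℕ.*-assoc (suc m) (m C k) _ ⟨
  suc m ℕ.* (m C k) ℕ.* (k ! ℕ.* (m ∸ k) !) ∎)
  where
  open ≡.≡-Reasoning
  open +-*-Solver
  instance _ = k ℕ.!* (m ∸ k) !≢0

∏-const : ∀ n x → ℕ∏.sum {n} (λ _ → x) ≡ x ℕ.^ n
∏-const zero    x = ≡.refl
∏-const (suc n) x = ≡.cong (x ℕ.*_) (∏-const n x)

∏-suc≡! : ∀ n → ℕ∏.sum {n} (λ i → suc (toℕ i)) ≡ n !
∏-suc≡! zero    = ≡.refl
∏-suc≡! (suc n) = begin
  ℕ∏.sum {suc n} (λ i → suc (toℕ i))
    ≡⟨ ℕ∏.sum-init-last {n} (λ i → suc (toℕ i)) ⟩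
  ℕ∏.sum {n} (λ i → suc (toℕ (inject₁ i))) ℕ.* suc (toℕ (fromℕ n))
    ≡⟨ ≡.cong₂ ℕ._*_ (≡.trans (ℕ∏.sum-cong-≋ {n} λ i → ≡.cong suc (toℕ-inject₁ i)) (∏-suc≡! n))
                     (≡.cong suc (toℕ-fromℕ n)) ⟩
  n ! ℕ.* suc n
    ≡⟨ ℕ.*-comm (n !) (suc n) ⟩
  suc n ! ∎
  where open ≡.≡-Reasoning

binomials : ∀ n → Fin (suc n) → ℕ
binomials n k = n C toℕ k

-- The factor `n C 0` is 1; the others come from `C-absorb` for k = 0, ..., m, where the factors k +
-- 1 multiply up to n! and the factors n to nⁿ.
∏-binomials : ∀ m → let n = suc m in n ! ℕ.* ℕ∏.sum (binomials n) ≡ n ℕ.^ n ℕ.* ℕ∏.sum (binomials m)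
∏-binomials m = begin
  n ! ℕ.* (1 ℕ.* ℕ∏.sum {n} (λ k → n C suc (toℕ k)))
    ≡⟨ solve 2 (λ f x → f :* (con 1 :* x) := x :* f) ≡.refl (n !) _ ⟩
  ℕ∏.sum {n} (λ k → n C suc (toℕ k)) ℕ.* n !
    ≡⟨ ≡.cong (ℕ∏.sum {n} (λ k → n C suc (toℕ k)) ℕ.*_) (∏-suc≡! n) ⟨
  ℕ∏.sum {n} (λ k → n C suc (toℕ k)) ℕ.* ℕ∏.sum {n} (λ k → suc (toℕ k))
    ≡⟨ ℕ∏.∑-distrib-+ {n} (λ k → n C suc (toℕ k)) (λ k → suc (toℕ k)) ⟨
  ℕ∏.sum {n} (λ k → (n C suc (toℕ k)) ℕ.* suc (toℕ k))
    ≡⟨ ℕ∏.sum-cong-≋ {n} (λ k → C-absorb (toℕ≤pred[n] k)) ⟩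
  ℕ∏.sum {n} (λ k → n ℕ.* (m C toℕ k))
    ≡⟨ ℕ∏.∑-distrib-+ {n} (λ _ → n) (binomials m) ⟩
  ℕ∏.sum {n} (λ _ → n) ℕ.* ℕ∏.sum (binomials m)
    ≡⟨ ≡.cong (ℕ._* ℕ∏.sum (binomials m)) (∏-const n n) ⟩
  n ℕ.^ n ℕ.* ℕ∏.sum (binomials m) ∎
  where
  n = suc m
  open ≡.≡-Reasoning
  open +-*-Solver

-- This relates the coefficients of the two sums over k and is the origin of (n!)² and nⁿ. Restoring
-- the missing factor C(n, k) gives the product in `∏-binomials`, which uses one n!; the other
-- splits as C(n, k) k! (n - k)!.
∏-binomials-punchIn : ∀ m (k : Fin (suc (suc m))) → let n = suc m in
  (n !) ℕ.^ 2 ℕ.* ℕ∏.sum (λ l → binomials n (punchIn k l)) ≡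
  n ℕ.^ n ℕ.* (ℕ∏.sum (binomials m) ℕ.* (toℕ k ! ℕ.* (n ∸ toℕ k) !))
∏-binomials-punchIn m k = ℕ.*-cancelʳ-≡ _ _ (n C toℕ k) (begin
  (n !) ℕ.^ 2 ℕ.* ℕ∏.sum (λ l → binomials n (punchIn k l)) ℕ.* (n C toℕ k)
    ≡⟨ solve 3 (λ f x c → f :* (f :* con 1) :* x :* c := f :* (f :* (c :* x))) ≡.refl (n !) _ (n C toℕ k) ⟩
  n ! ℕ.* (n ! ℕ.* ((n C toℕ k) ℕ.* ℕ∏.sum (λ l → binomials n (punchIn k l))))
    ≡⟨ ≡.cong (λ x → n ! ℕ.* (n ! ℕ.* x)) (ℕ∏.sum-remove {i = k} (binomials n)) ⟨
  n ! ℕ.* (n ! ℕ.* ℕ∏.sum (binomials n))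
    ≡⟨ ≡.cong (n ! ℕ.*_) (∏-binomials m) ⟩
  n ! ℕ.* (n ℕ.^ n ℕ.* ℕ∏.sum (binomials m))
    ≡⟨ ≡.cong (ℕ._* (n ℕ.^ n ℕ.* ℕ∏.sum (binomials m))) (C*k![n∸k]! (toℕ≤pred[n] k)) ⟨
  (n C toℕ k) ℕ.* (toℕ k ! ℕ.* (n ∸ toℕ k) !) ℕ.* (n ℕ.^ n ℕ.* ℕ∏.sum (binomials m))
    ≡⟨ solve 4 (λ c b p q → c :* b :* (p :* q) := p :* (q :* b) :* c) ≡.refl (n C toℕ k) _ (n ℕ.^ n) _ ⟩
  n ℕ.^ n ℕ.* (ℕ∏.sum (binomials m) ℕ.* (toℕ k ! ℕ.* (n ∸ toℕ k) !)) ℕ.* (n C toℕ k) ∎)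
  where
  n = suc m
  open ≡.≡-Reasoning
  open +-*-Solver
  instance
    C≢0 : ℕ.NonZero (n C toℕ k)
    C≢0 = ℕ.m*n≢0⇒m≢0 (n C toℕ k) {{≡.subst ℕ.NonZero (≡.sym (C*k![n∸k]! (toℕ≤pred[n] k))) (n ℕ.!≢0)}}

-- Finite sums over a commutative ring

module RankTwo {c ℓ : Level} (R : CommutativeRing c ℓ) where

  open CommutativeRing R hiding (zero)
  open Matrices R
  open import Algebra.Properties.CommutativeSemigroup *-commutativeSemigroup using (x∙yz≈y∙xz)
  open import Algebra.Properties.CommutativeSemiring.Binomial commutativeSemiring
    using () renaming (theorem to binomial-theorem)
  open import Algebra.Properties.CommutativeSemiring.Exp commutativeSemiring using (^-distrib-*; ^-homo-*; ^-congˡ)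
  open import Algebra.Properties.Ring ring using (-0#≈0#; -1*x≈-x; -‿involutive)
  open import Algebra.Properties.Semiring.Mult semiring using (×1-homo-*)
  import Algebra.Properties.Semiring.Sum semiring as Sum
  import Algebra.Properties.CommutativeMonoid.Sum *-commutativeMonoid as Product
  open import Algebra.Solver.Ring.NaturalCoefficients.Default commutativeSemiring
    using (solve; _:+_; _:*_; _:=_; con)
  open import Relation.Binary.Reasoning.Setoid setoid

  -- Opaque, so that the summand is recovered by unification.
  opaque
    ∑ ∏ : ∀ {n} → Vector Carrier n → Carrier
    ∑ = sum
    ∏ = product

    ∑≈sum : ∀ {n} (f : Vector Carrier n) → ∑ f ≈ sum f
    ∑≈sum f = refl

    ∑-empty : (f : Vector Carrier 0) → ∑ f ≈ 0#
    ∑-empty f = refl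

    ∏-empty : (f : Vector Carrier 0) → ∏ f ≈ 1#
    ∏-empty f = refl

    ∑-suc : ∀ {n} (f : Vector Carrier (suc n)) → ∑ f ≈ f zero + ∑ λ i → f (suc i)
    ∑-suc f = refl

    ∏-suc : ∀ {n} (f : Vector Carrier (suc n)) → ∏ f ≈ f zero * ∏ λ i → f (suc i)
    ∏-suc f = refl

    ∑-cong : ∀ {n} {f g : Vector Carrier n} → (∀ i → f i ≈ g i) → ∑ f ≈ ∑ g
    ∑-cong = Sum.sum-cong-≋

    ∑-remove : ∀ {n} k (f : Vector Carrier (suc n)) → ∑ f ≈ f k + ∑ λ i → f (punchIn k i)
    ∑-remove k f = Sum.sum-remove {i = k} f

    ∏-remove : ∀ {n} k (f : Vector Carrier (suc n)) → ∏ f ≈ f k * ∏ λ i → f (punchIn k i)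
    ∏-remove k f = Product.sum-remove {i = k} f

    ∑-+ : ∀ {n} (f g : Vector Carrier n) → ∑ (λ i → f i + g i) ≈ ∑ f + ∑ g
    ∑-+ = Sum.∑-distrib-+

    ∑-comm : ∀ {m n} (f : Fin m → Fin n → Carrier) →
      (∑ λ i → ∑ λ j → f i j) ≈ ∑ λ j → ∑ λ i → f i j
    ∑-comm = Sum.∑-comm

    *-∑ : ∀ {n} x (f : Vector Carrier n) → x * ∑ f ≈ ∑ λ i → x * f i
    *-∑ = Sum.*-distribˡ-sum

    ∑-0 : ∀ {n} {f : Vector Carrier n} → (∀ i → f i ≈ 0#) → ∑ f ≈ 0#
    ∑-0 {n} f≈0 = trans (Sum.sum-cong-≋ f≈0) (Sum.sum-replicate-zero n)

  ∑∑-suc : ∀ {m n} (h : Fin (suc m) → Fin (suc n) → Carrier) → (∑ λ k → ∑ λ l → h k l) ≈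
    (∑ λ l → h zero l) + ((∑ λ k → h (suc k) zero) + ∑ λ k → ∑ λ l → h (suc k) (suc l))
  ∑∑-suc h = trans (∑-suc _) (+-congˡ (trans (∑-cong λ k → ∑-suc _) (∑-+ _ _)))

  ∑∑-2 : (h : Fin 2 → Fin 1 → Carrier) → (∑ λ k → ∑ λ l → h k l) ≈ h zero zero + h (suc zero) zero
  ∑∑-2 h = begin
    (∑ λ k → ∑ λ l → h k l)
      ≈⟨ trans (∑-cong λ k → trans (trans (∑-suc _) (+-congˡ (∑-empty _))) (+-identityʳ _)) (∑-suc _) ⟩
    h zero zero + ∑ (λ k → h (suc k) zero)
      ≈⟨ +-congˡ (trans (trans (∑-suc _) (+-congˡ (∑-empty _))) (+-identityʳ _)) ⟩
    h zero zero + h (suc zero) zero ∎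

  -- Reversing a pair of positions is a bijection. It exchanges the pairs that start in 0, the row k
  -- = 0, with those that end in 0, the column l = 0 below it; the rest is the case of one position
  -- fewer.
  ∑-cross : ∀ {n} (h : Fin (suc (suc n)) → Fin (suc n) → Carrier) →
    (∑ λ k → ∑ λ l → h k l) ≈ ∑ λ k → ∑ λ l → h (punchIn k l) (cross k l)
  ∑-cross {zero} h = trans (∑∑-2 h) (trans (+-comm _ _) (sym (∑∑-2 _)))
  ∑-cross {suc n} h = begin
    (∑ λ k → ∑ λ l → h k l)
      ≈⟨ ∑∑-suc h ⟩
    A + (B + (∑ λ k → ∑ λ l → h (suc k) (suc l)))
      ≈⟨ +-congˡ (+-congˡ (∑-cross λ k l → h (suc k) (suc l))) ⟩
    A + (B + C)
      ≈⟨ solve 3 (λ a b c → a :+ (b :+ c) := b :+ (a :+ c)) refl A B C ⟩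
    B + (A + C)
      ≈⟨ ∑∑-suc _ ⟨
    (∑ λ k → ∑ λ l → h (punchIn k l) (cross k l)) ∎
    where
    A = ∑ λ l → h zero l
    B = ∑ λ k → h (suc k) zero
    C = ∑ λ k → ∑ λ l → h (punchIn (suc k) (suc l)) (cross (suc k) (suc l))

  -- Each pair cancels against its reverse. Adding the two sides of `∑-cross` would only show that
  -- twice the sum is 0, and 2 may be a zero divisor.
  ∑-antisymmetric : ∀ {n} (h : Fin (suc (suc n)) → Fin (suc n) → Carrier) →
    (∀ k l → h k l + h (punchIn k l) (cross k l) ≈ 0#) → (∑ λ k → ∑ λ l → h k l) ≈ 0#
  ∑-antisymmetric {zero} h anti = trans (∑∑-2 h) (anti zero zero)
  ∑-antisymmetric {suc n} h anti = begin
    (∑ λ k → ∑ λ l → h k l)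
      ≈⟨ ∑∑-suc h ⟩
    A + (B + C)
      ≈⟨ +-assoc A B C ⟨
    (A + B) + C
      ≈⟨ +-cong (trans (sym (∑-+ _ _)) (∑-0 (anti zero)))
                (∑-antisymmetric (λ k l → h (suc k) (suc l)) (λ k l → anti (suc k) (suc l))) ⟩
    0# + 0#
      ≈⟨ +-identityˡ 0# ⟩
    0# ∎
    where
    A = ∑ λ l → h zero l
    B = ∑ λ k → h (suc k) zero
    C = ∑ λ k → ∑ λ l → h (suc k) (suc l)

  ∑∑-cong : ∀ {m n} {f g : Fin m → Fin n → Carrier} → (∀ i j → f i j ≈ g i j) →
    (∑ λ i → ∑ λ j → f i j) ≈ ∑ λ i → ∑ λ j → g i j
  ∑∑-cong f≈g = ∑-cong λ i → ∑-cong (f≈g i)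

  -- Determinants and permanents by Laplace expansion

  -- The common generalisation of determinant (ε = −1) and permanent (ε = 1).
  Δ : Carrier → ∀ {n} → Matrix n n → Carrier
  Δ ε {zero}  B = 1#
  Δ ε {suc n} B = ∑ λ k → ε ^ toℕ k * (B zero k * Δ ε λ i j → B (suc i) (punchIn k j))

  Δ-cong : ∀ ε {n} {A B : Matrix n n} → (∀ i j → A i j ≈ B i j) → Δ ε A ≈ Δ ε B
  Δ-cong ε {zero}  A≈B = refl
  Δ-cong ε {suc n} A≈B = ∑-cong λ k →
    *-congˡ (*-cong (A≈B zero k) (Δ-cong ε λ i j → A≈B (suc i) (punchIn k j)))

  Δ-scale : ∀ ε {n} (d : Vector Carrier n) (B : Matrix n n) →
    Δ ε (λ i j → d j * B i j) ≈ ∏ d * Δ ε B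
  Δ-scale ε {zero}  d B = sym (trans (*-identityʳ _) (∏-empty d))
  Δ-scale ε {suc n} d B = begin
    ∑ (λ k → ε ^ toℕ k * (d k * B zero k * Δ ε λ i j → d (punchIn k j) * B (suc i) (punchIn k j)))
      ≈⟨ (∑-cong λ k → trans (*-congˡ (*-congˡ (Δ-scale ε (d ∘ punchIn k) _)))
           (trans (solve 5 (λ e x b p m → e :* (x :* b :* (p :* m)) := x :* p :* (e :* (b :* m))) refl _ _ _ _ _)
             (*-congʳ (sym (∏-remove k d))))) ⟩
    ∑ (λ k → ∏ d * (ε ^ toℕ k * (B zero k * Δ ε λ i j → B (suc i) (punchIn k j))))
      ≈⟨ *-∑ (∏ d) _ ⟨
    ∏ d * Δ ε B ∎

  Δ-zero-row : ∀ ε {n} (B : Matrix (suc n) (suc n)) → (∀ k → B zero k ≈ 0#) → Δ ε B ≈ 0#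
  Δ-zero-row ε B B≈0 = ∑-0 λ k → trans (*-congˡ (trans (*-congʳ (B≈0 k)) (zeroˡ _))) (zeroʳ _)

  **-∑ : ∀ x y {n} (f : Vector Carrier n) → x * (y * ∑ f) ≈ ∑ λ i → x * (y * f i)
  **-∑ x y f = trans (*-congˡ (*-∑ y f)) (*-∑ x _)

  -- Apart from the corner entry, both expansions reach the minors without rows 0, i + 1 and columns
  -- 0, k + 1, with the same power of ε.
  Δ-column : ∀ ε {n} (B : Matrix (suc n) (suc n)) →
    Δ ε B ≈ ∑ λ i → ε ^ toℕ i * (B i zero * Δ ε λ i′ j → B (punchIn i i′) (suc j))
  Δ-column ε {zero}  B = ∑-cong λ { zero → refl }
  Δ-column ε {suc n} B = begin
    Δ ε B
      ≈⟨ trans (∑-suc _) (+-congˡ (∑-cong λ k → trans (*-congˡ (*-congˡ (Δ-column ε λ i j → B (suc i) (punchIn (suc k) j)))) (**-∑ _ _ _))) ⟩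
    B₀ + (∑ λ k → ∑ λ i → ε ^ suc (toℕ k) * (B zero (suc k) * (ε ^ toℕ i * (B (suc i) zero * M i k))))
      ≈⟨ +-congˡ (∑-comm _) ⟩
    B₀ + (∑ λ i → ∑ λ k → ε ^ suc (toℕ k) * (B zero (suc k) * (ε ^ toℕ i * (B (suc i) zero * M i k))))
      ≈⟨ +-congˡ (∑∑-cong λ i k → solve 6 (λ e p q b c m → e :* p :* (b :* (q :* (c :* m))) := e :* q :* (c :* (p :* (b :* m))))
           refl ε (ε ^ toℕ k) (ε ^ toℕ i) (B zero (suc k)) (B (suc i) zero) (M i k)) ⟩
    B₀ + (∑ λ i → ∑ λ k → ε ^ suc (toℕ i) * (B (suc i) zero * (ε ^ toℕ k * (B zero (suc k) * M i k))))
      ≈⟨ trans (∑-suc _) (+-congˡ (∑-cong λ i → **-∑ _ _ _)) ⟨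
    (∑ λ i → ε ^ toℕ i * (B i zero * Δ ε λ i′ j → B (punchIn i i′) (suc j))) ∎
    where
    M : Fin (suc n) → Fin (suc n) → Carrier
    M i k = Δ ε λ i′ j → B (suc (punchIn i i′)) (suc (punchIn k j))
    B₀ = 1# * (B zero zero * Δ ε λ i j → B (suc i) (suc j))

  Δ-transpose : ∀ ε {n} (B : Matrix n n) → Δ ε (λ i j → B j i) ≈ Δ ε B
  Δ-transpose ε {zero}  B = refl
  Δ-transpose ε {suc n} B = trans
    (∑-cong λ k → *-congˡ {ε ^ toℕ k} (*-congˡ {B k zero} (Δ-transpose ε (λ i j → B (punchIn k i) (suc j)))))
    (sym (Δ-column ε B))

  -- The position deleted second has its index lowered by one exactly when it is the larger of the
  -- two. Reversing the pair thus changes the exponent by one, up or down, and ε² = 1 makes either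
  -- change a factor ε.
  cross-sign : ∀ {ε} → ε * ε ≈ 1# → ∀ {n} (k : Fin (suc (suc n))) l →
    ε ^ toℕ (punchIn k l) * ε ^ toℕ (cross k l) ≈ ε * (ε ^ toℕ k * ε ^ toℕ l)
  cross-sign {ε} εε zero    l    = solve 2 (λ e x → e :* x :* con 1 := e :* (con 1 :* x)) refl ε (ε ^ toℕ l)
  cross-sign {ε} εε (suc k) zero = begin
    1# * ε ^ toℕ k                ≈⟨ *-congʳ εε ⟨
    ε * ε * ε ^ toℕ k             ≈⟨ solve 2 (λ e x → e :* e :* x := e :* (e :* x :* con 1)) refl ε (ε ^ toℕ k) ⟩
    ε * (ε * ε ^ toℕ k * 1#)      ∎
  cross-sign {ε} εε {suc n} (suc k) (suc l) = begin
    ε * ε ^ toℕ (punchIn k l) * (ε * ε ^ toℕ (cross k l))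
      ≈⟨ solve 3 (λ e x y → e :* x :* (e :* y) := e :* e :* (x :* y)) refl _ _ _ ⟩
    ε * ε * (ε ^ toℕ (punchIn k l) * ε ^ toℕ (cross k l))
      ≈⟨ *-congˡ (cross-sign εε k l) ⟩
    ε * ε * (ε * (ε ^ toℕ k * ε ^ toℕ l))
      ≈⟨ solve 3 (λ e x y → e :* e :* (e :* (x :* y)) := e :* (e :* x :* (e :* y))) refl _ _ _ ⟩
    ε * (ε * ε ^ toℕ k * (ε * ε ^ toℕ l)) ∎

  -- Row 0 is expanded first and row i + 1 in each of its minors; `∑-cross` lets the column of row i
  -- + 1 be chosen first instead, and `cross-sign` supplies the additional factor ε.
  Δ-row : ∀ {ε} → ε * ε ≈ 1# → ∀ {n} (B : Matrix (suc n) (suc n)) i →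
    Δ ε B ≈ ∑ λ k → ε ^ toℕ i * ε ^ toℕ k * (B i k * Δ ε λ i′ j → B (punchIn i i′) (punchIn k j))
  Δ-row εε B zero = ∑-cong λ k → *-congʳ (sym (*-identityˡ _))
  Δ-row {ε} εε {suc n} B (suc i) = begin
    ∑ (λ k → ε ^ toℕ k * (B zero k * Δ ε λ i′ j → B (suc i′) (punchIn k j)))
      ≈⟨ (∑-cong λ k → trans (*-congˡ (*-congˡ (Δ-row εε (λ i′ j → B (suc i′) (punchIn k j)) i))) (**-∑ _ _ _)) ⟩
    (∑ λ k → ∑ λ l → h k l)
      ≈⟨ ∑-cross h ⟩
    (∑ λ k → ∑ λ l → h (punchIn k l) (cross k l))
      ≈⟨ ∑∑-cong resort ⟩
    (∑ λ k → ∑ λ l → ε ^ suc (toℕ i) * ε ^ toℕ k * (B (suc i) k * (ε ^ toℕ l * (B zero (punchIn k l) * M k l))))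
      ≈⟨ (∑-cong λ k → **-∑ _ _ _) ⟨
    (∑ λ k → ε ^ suc (toℕ i) * ε ^ toℕ k * (B (suc i) k * Δ ε λ i′ j → B (punchIn (suc i) i′) (punchIn k j))) ∎
    where
    M : Fin (suc (suc n)) → Fin (suc n) → Carrier
    M k l = Δ ε λ i′ j → B (suc (punchIn i i′)) (punchIn k (punchIn l j))
    h : Fin (suc (suc n)) → Fin (suc n) → Carrier
    h k l = ε ^ toℕ k * (B zero k * (ε ^ toℕ i * ε ^ toℕ l * (B (suc i) (punchIn k l) * M k l)))
    resort : ∀ k l → h (punchIn k l) (cross k l) ≈
      ε ^ suc (toℕ i) * ε ^ toℕ k * (B (suc i) k * (ε ^ toℕ l * (B zero (punchIn k l) * M k l)))
    resort k l = begin
      h (punchIn k l) (cross k l)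
        ≈⟨ solve 6 (λ p b s q c m → p :* (b :* (s :* q :* (c :* m))) := (p :* q) :* (b :* (s :* (c :* m)))) refl _ _ _ _ _ _ ⟩
      ε ^ toℕ (punchIn k l) * ε ^ toℕ (cross k l) * (B zero (punchIn k l) * (ε ^ toℕ i *
        (B (suc i) (punchIn (punchIn k l) (cross k l)) * M (punchIn k l) (cross k l))))
        ≈⟨ *-cong (cross-sign εε k l) (*-congˡ (*-congˡ (*-cong
             (reflexive (≡.cong (B (suc i)) (punchIn-cross k l)))
             (Δ-cong ε λ i′ j → reflexive (≡.cong (B (suc (punchIn i i′))) (punchIn-punchIn k l j)))))) ⟩
      ε * (ε ^ toℕ k * ε ^ toℕ l) * (B zero (punchIn k l) * (ε ^ toℕ i * (B (suc i) k * M k l)))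
        ≈⟨ solve 7 (λ e p q b s c m → e :* (p :* q) :* (b :* (s :* (c :* m))) := e :* s :* p :* (c :* (q :* (b :* m)))) refl _ _ _ _ _ _ _ ⟩
      ε ^ suc (toℕ i) * ε ^ toℕ k * (B (suc i) k * (ε ^ toℕ l * (B zero (punchIn k l) * M k l))) ∎

  Δ-rows₂ : ∀ ε {n} (B : Matrix (suc (suc n)) (suc (suc n))) →
    Δ ε B ≈ ∑ λ k → ∑ λ l → ε ^ toℕ k * ε ^ toℕ l *
      (B zero k * B (suc zero) (punchIn k l) * Δ ε λ i j → B (suc (suc i)) (punchIn k (punchIn l j)))
  Δ-rows₂ ε B = ∑-cong λ k → trans (**-∑ _ _ _) (∑-cong λ l →
    solve 5 (λ p b q c m → p :* (b :* (q :* (c :* m))) := p :* q :* (b :* c :* m)) refl _ _ _ _ _)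

  -- Alternating functions

  -1*-1≈1 : - 1# * - 1# ≈ 1#
  -1*-1≈1 = trans (-1*x≈-x (- 1#)) (-‿involutive 1#)

  -- In the expansion along two equal rows, each pair of columns cancels against its reverse.
  det-equal-rows : ∀ {n} (B : Matrix (suc (suc n)) (suc (suc n))) →
    (∀ j → B zero j ≈ B (suc zero) j) → Δ (- 1#) B ≈ 0#
  det-equal-rows {n} B eq = trans (Δ-rows₂ (- 1#) B) (∑-antisymmetric h λ k l → begin
    h k l + h (punchIn k l) (cross k l)
      ≈⟨ +-congˡ (*-cong (cross-sign -1*-1≈1 k l) (*-cong (trans (*-cong (eq _)
           (trans (reflexive (≡.cong (B (suc zero)) (punchIn-cross k l))) (sym (eq k)))) (*-comm _ _))
           (Δ-cong (- 1#) λ i j → reflexive (≡.cong (B (suc (suc i))) (punchIn-punchIn k l j))))) ⟩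
    h k l + - 1# * ((- 1#) ^ toℕ k * (- 1#) ^ toℕ l) * (B zero k * B (suc zero) (punchIn k l) * M k l)
      ≈⟨ +-congˡ (trans (*-assoc _ _ _) (-1*x≈-x _)) ⟩
    h k l - h k l
      ≈⟨ -‿inverseʳ _ ⟩
    0# ∎)
    where
    M : Fin (suc (suc n)) → Fin (suc n) → Carrier
    M k l = Δ (- 1#) λ i j → B (suc (suc i)) (punchIn k (punchIn l j))
    h : Fin (suc (suc n)) → Fin (suc n) → Carrier
    h k l = (- 1#) ^ toℕ k * (- 1#) ^ toℕ l * (B zero k * B (suc zero) (punchIn k l) * M k l)

  det-swap-rows : ∀ {n} (A B : Matrix (suc (suc n)) (suc (suc n))) →
    (∀ j → A zero j ≈ B (suc zero) j) → (∀ j → A (suc zero) j ≈ B zero j) →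
    (∀ i j → A (suc (suc i)) j ≈ B (suc (suc i)) j) → Δ (- 1#) A ≈ - Δ (- 1#) B
  det-swap-rows {n} A B A₀ A₁ A₂ = begin
    Δ (- 1#) A
      ≈⟨ Δ-rows₂ (- 1#) A ⟩
    (∑ λ k → ∑ λ l → h k l)
      ≈⟨ ∑-cross h ⟩
    (∑ λ k → ∑ λ l → h (punchIn k l) (cross k l))
      ≈⟨ ∑∑-cong (λ k l → trans (*-cong (cross-sign -1*-1≈1 k l) (*-cong
           (trans (*-cong (A₀ _) (trans (A₁ _) (reflexive (≡.cong (B zero) (punchIn-cross k l))))) (*-comm _ _))
           (Δ-cong (- 1#) λ i j → trans (A₂ i _) (reflexive (≡.cong (B (suc (suc i))) (punchIn-punchIn k l j))))))
         (*-assoc _ _ _)) ⟩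
    (∑ λ k → ∑ λ l → - 1# * h′ k l)
      ≈⟨ trans (*-∑ _ _) (∑-cong λ k → *-∑ _ _) ⟨
    - 1# * (∑ λ k → ∑ λ l → h′ k l)
      ≈⟨ -1*x≈-x _ ⟩
    - (∑ λ k → ∑ λ l → h′ k l)
      ≈⟨ -‿cong (Δ-rows₂ (- 1#) B) ⟨
    - Δ (- 1#) B ∎
    where
    h h′ : Fin (suc (suc n)) → Fin (suc n) → Carrier
    h k l = (- 1#) ^ toℕ k * (- 1#) ^ toℕ l *
      (A zero k * A (suc zero) (punchIn k l) * Δ (- 1#) λ i j → A (suc (suc i)) (punchIn k (punchIn l j)))
    h′ k l = (- 1#) ^ toℕ k * (- 1#) ^ toℕ l *
      (B zero k * B (suc zero) (punchIn k l) * Δ (- 1#) λ i j → B (suc (suc i)) (punchIn k (punchIn l j)))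

  -- `stutter` is a separate field, since `swap` gives only 2 D f = 0 on a word with a repetition.
  record Alternating {i} {I : Set i} {n} (D : Vec I n → Carrier) : Set (i ⊔ ℓ) where
    field
      swap    : ∀ {f g} → Swap f g → D f ≈ - D g
      stutter : ∀ {f} → Stutter f → D f ≈ 0#

  open Alternating

  select : ∀ {i} {I : Set i} {n m} → (I → Vector Carrier m) → Vec I n → Matrix n m
  select r f i = r (lookup f i)

  -- `r` is arbitrary so that the recursion can pass to minors, whose rows are those of `r` with one
  -- column deleted.
  det-alternating : ∀ {i} {I : Set i} {n} (r : I → Vector Carrier n) →
    Alternating λ f → Δ (- 1#) (select r f)
  det-alternating r .swap (here {x = x} {y} {f}) =
    det-swap-rows (select r (x ∷ y ∷ f)) (select r (y ∷ x ∷ f)) (λ _ → refl) (λ _ → refl) (λ _ _ → refl)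
  det-alternating r .swap (there {x = x} {f} {g} s) = begin
    (∑ λ k → (- 1#) ^ toℕ k * (r x k * Δ (- 1#) λ i j → r (lookup f i) (punchIn k j)))
      ≈⟨ ∑-cong (λ k → trans (*-congˡ (trans (*-congˡ (trans (det-alternating (λ x j → r x (punchIn k j)) .swap s)
           (sym (-1*x≈-x _)))) (x∙yz≈y∙xz _ _ _))) (x∙yz≈y∙xz _ _ _)) ⟩
    (∑ λ k → - 1# * ((- 1#) ^ toℕ k * (r x k * Δ (- 1#) λ i j → r (lookup g i) (punchIn k j))))
      ≈⟨ *-∑ _ _ ⟨
    - 1# * Δ (- 1#) (select r (x ∷ g))
      ≈⟨ -1*x≈-x _ ⟩
    - Δ (- 1#) (select r (x ∷ g)) ∎
  det-alternating r .stutter (here {x = x} {f}) = det-equal-rows (select r (x ∷ x ∷ f)) λ _ → refl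
  det-alternating r .stutter (there s) = ∑-0 λ k →
    trans (*-congˡ (trans (*-congˡ (det-alternating (λ x j → r x (punchIn k j)) .stutter s)) (zeroʳ _))) (zeroʳ _)

  module _ {i : Level} {I : Set i} where

    alternating-∷ : ∀ {n} {D : Vec I (suc n) → Carrier} → Alternating D →
      ∀ x → Alternating (D ∘ (x ∷_))
    alternating-∷ alt x .swap    s = alt .swap (there s)
    alternating-∷ alt x .stutter s = alt .stutter (there s)

    alternating-map : ∀ {j} {J : Set j} {n} {D : Vec I n → Carrier} → Alternating D →
      (h : J → I) → Alternating (D ∘ map h)
    alternating-map alt h .swap    s = alt .swap (map-Swap h s)
    alternating-map alt h .stutter s = alt .stutter (map-Stutter h s)

    alternating-repeated : ∀ {n} {D : Vec I (suc n) → Carrier} → Alternating D →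
      ∀ f i {x} → lookup f i ≡ x → D (x ∷ f) ≈ 0#
    alternating-repeated     alt (_ ∷ f) zero    ≡.refl = alt .stutter here
    alternating-repeated {D = D} alt (y ∷ f) (suc i) {x} eq = begin
      D (x ∷ y ∷ f)    ≈⟨ alt .swap here ⟩
      - D (y ∷ x ∷ f)  ≈⟨ -‿cong (alternating-repeated (alternating-∷ alt y) f i eq) ⟩
      - 0#             ≈⟨ -0#≈0# ⟩
      0#               ∎

    -- The letter at position k passes the k letters before it, by one adjacent swap each.
    alternating-move : ∀ {n} {D : Vec I (suc n) → Carrier} → Alternating D →
      ∀ k (g : Fin (suc n) → I) →
      D (g k ∷ tabulate (g ∘ punchIn k)) ≈ (- 1#) ^ toℕ k * D (tabulate g)
    alternating-move             alt zero    g = sym (*-identityˡ _)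
    alternating-move {suc n} {D} alt (suc k) g = begin
      D (g (suc k) ∷ g zero ∷ tabulate (g ∘ suc ∘ punchIn k))
        ≈⟨ alt .swap here ⟩
      - D (g zero ∷ g (suc k) ∷ tabulate (g ∘ suc ∘ punchIn k))
        ≈⟨ -‿cong (alternating-move (alternating-∷ alt (g zero)) k (g ∘ suc)) ⟩
      - ((- 1#) ^ toℕ k * D (tabulate g))
        ≈⟨ trans (*-assoc _ _ _) (-1*x≈-x _) ⟨
      (- 1#) ^ toℕ (suc k) * D (tabulate g) ∎

  -- Multilinear expansion and the Cauchy-Binet formula

  -- ∑ over f of ∏ᵢ c i (f i) · D f.
  expand : ∀ {n m} → Matrix n m → (Vec (Fin m) n → Carrier) → Carrier
  expand {zero}  c D = D []
  expand {suc n} c D = ∑ λ k → c zero k * expand (c ∘ suc) (D ∘ (k ∷_))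

  expand-cong : ∀ {n m} (c : Matrix n m) {D E : Vec (Fin m) n → Carrier} →
    (∀ f → D f ≈ E f) → expand c D ≈ expand c E
  expand-cong {zero}  c D≈E = D≈E []
  expand-cong {suc n} c D≈E = ∑-cong λ k → *-congˡ (expand-cong (c ∘ suc) (D≈E ∘ (k ∷_)))

  expand-* : ∀ {n m} (c : Matrix n m) x (D : Vec (Fin m) n → Carrier) →
    expand c (λ f → x * D f) ≈ x * expand c D
  expand-* {zero}  c x D = refl
  expand-* {suc n} c x D = trans
    (∑-cong λ k → trans (*-congˡ (expand-* (c ∘ suc) x (D ∘ (k ∷_)))) (x∙yz≈y∙xz _ _ _))
    (sym (*-∑ _ _))

  expand-∑ : ∀ {n m p} (c : Matrix n m) (D : Fin p → Vec (Fin m) n → Carrier) →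
    expand c (λ f → ∑ λ j → D j f) ≈ ∑ λ j → expand c (D j)
  expand-∑ {zero}  c D = refl
  expand-∑ {suc n} c D = trans
    (∑-cong λ k → trans (*-congˡ (expand-∑ (c ∘ suc) (λ j → D j ∘ (k ∷_)))) (*-∑ _ _))
    (∑-comm _)

  expand-0 : ∀ {n m} (c : Matrix n m) {D : Vec (Fin m) n → Carrier} →
    (∀ f → D f ≈ 0#) → expand c D ≈ 0#
  expand-0 {zero}  c D≈0 = D≈0 []
  expand-0 {suc n} c D≈0 = ∑-0 λ k → trans (*-congˡ (expand-0 (c ∘ suc) (D≈0 ∘ (k ∷_)))) (zeroʳ _)

  -- Only words that avoid the letter k contribute, and those are the words in the remaining
  -- letters, renamed by `punchIn k`.
  expand-punchIn : ∀ {n m} (c : Matrix n (suc m)) k (D : Vec (Fin (suc m)) n → Carrier) →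
    (∀ f i → lookup f i ≡ k → D f ≈ 0#) →
    expand c D ≈ expand (λ i j → c i (punchIn k j)) (D ∘ map (punchIn k))
  expand-punchIn {zero}  c k D D≈0 = refl
  expand-punchIn {suc n} c k D D≈0 = begin
    expand c D
      ≈⟨ ∑-remove k _ ⟩
    c zero k * expand (c ∘ suc) (D ∘ (k ∷_)) +
      (∑ λ l → c zero (punchIn k l) * expand (c ∘ suc) (D ∘ (punchIn k l ∷_)))
      ≈⟨ +-cong (trans (*-congˡ (expand-0 (c ∘ suc) λ f → D≈0 (k ∷ f) zero ≡.refl)) (zeroʳ _))
                (∑-cong λ l → *-congˡ (expand-punchIn (c ∘ suc) k _ λ f i → D≈0 (punchIn k l ∷ f) (suc i))) ⟩
    0# + expand (λ i j → c i (punchIn k j)) (D ∘ map (punchIn k))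
      ≈⟨ +-identityˡ _ ⟩
    expand (λ i j → c i (punchIn k j)) (D ∘ map (punchIn k)) ∎

  -- Multilinearity in the rows: a word picks one summand of the combination in every row.
  Δ-expand : ∀ ε {n m} (c : Matrix n m) (r : Fin n → Fin m → Vector Carrier n) →
    Δ ε (λ i j → ∑ λ s → c i s * r i s j) ≈ expand c λ f → Δ ε λ i → r i (lookup f i)
  Δ-expand ε c r = go c r
    where
    go : ∀ {n m} (c : Matrix n m) (r : Fin n → Fin m → Vector Carrier n) →
      Δ ε (λ i j → ∑ λ s → c i s * r i s j) ≈ expand c λ f → Δ ε λ i → r i (lookup f i)
    go {zero}      c r = refl
    go {suc n} {m} c r = begin
      (∑ λ j → ε ^ toℕ j * ((∑ λ s → c zero s * r zero s j) *
        Δ ε λ i j′ → ∑ λ s → c (suc i) s * r (suc i) s (punchIn j j′)))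
        ≈⟨ ∑-cong (λ j → *-congˡ (*-congˡ (go (c ∘ suc) (λ i s j′ → r (suc i) s (punchIn j j′))))) ⟩
      (∑ λ j → ε ^ toℕ j * ((∑ λ s → c zero s * r zero s j) * E j))
        ≈⟨ ∑-cong (λ j → trans (*-congˡ (*-comm _ _)) (**-∑ _ _ _)) ⟩
      (∑ λ j → ∑ λ s → ε ^ toℕ j * (E j * (c zero s * r zero s j)))
        ≈⟨ ∑-comm _ ⟩
      (∑ λ s → ∑ λ j → ε ^ toℕ j * (E j * (c zero s * r zero s j)))
        ≈⟨ ∑∑-cong (λ s j → solve 4 (λ e x c r → e :* (x :* (c :* r)) := c :* (e :* (r :* x))) refl _ _ _ _) ⟩
      (∑ λ s → ∑ λ j → c zero s * (ε ^ toℕ j * (r zero s j * E j)))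
        ≈⟨ ∑-cong (λ s → *-∑ _ _) ⟨
      (∑ λ s → c zero s * ∑ λ j → ε ^ toℕ j * (r zero s j * E j))
        ≈⟨ ∑-cong (λ s → *-congˡ (trans (expand-∑ (c ∘ suc) _) (∑-cong λ j →
             trans (expand-* (c ∘ suc) _ _) (*-congˡ (expand-* (c ∘ suc) _ _))))) ⟨
      expand c (λ f → Δ ε λ i → r i (lookup f i)) ∎
      where
      E : Fin (suc n) → Carrier
      E j = expand (c ∘ suc) λ f → Δ ε λ i j′ → r (suc i) (lookup f i) (punchIn j j′)

  alternating-expand-∷ : ∀ {n m} (c : Matrix n (suc m)) {D : Vec (Fin (suc m)) (suc n) → Carrier} →
    Alternating D → ∀ k →
    expand c (D ∘ (k ∷_)) ≈ expand (λ i j → c i (punchIn k j)) (D ∘ (k ∷_) ∘ map (punchIn k))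
  alternating-expand-∷ c alt k = expand-punchIn c k _ λ f i → alternating-repeated alt f i

  -- Words that repeat a letter drop out, and moving the first letter k back to its place in the
  -- alphabet gives the sign of the expansion along row 0. With a determinant for `D` this is
  -- multiplicativity.
  expand-square : ∀ {n} (c : Matrix n n) {D : Vec (Fin n) n → Carrier} → Alternating D →
    expand c D ≈ Δ (- 1#) c * D (tabulate id)
  expand-square {zero}  c     alt = sym (*-identityˡ _)
  expand-square {suc n} c {D} alt = begin
    (∑ λ k → c zero k * expand (c ∘ suc) (D ∘ (k ∷_)))
      ≈⟨ ∑-cong (λ k → *-congˡ (trans (alternating-expand-∷ (c ∘ suc) alt k)
           (trans (expand-square (M k) (alternating-map (alternating-∷ alt k) (punchIn k)))
                  (*-congˡ (trans (reflexive (≡.cong (D ∘ (k ∷_)) (≡.sym (tabulate-∘ (punchIn k) id))))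
                                  (alternating-move alt k id)))))) ⟩
    (∑ λ k → c zero k * (Δ (- 1#) (M k) * ((- 1#) ^ toℕ k * D (tabulate id))))
      ≈⟨ ∑-cong (λ k → solve 4 (λ c m e d → c :* (m :* (e :* d)) := d :* (e :* (c :* m))) refl _ _ _ _) ⟩
    (∑ λ k → D (tabulate id) * ((- 1#) ^ toℕ k * (c zero k * Δ (- 1#) (M k))))
      ≈⟨ trans (*-comm _ _) (*-∑ _ _) ⟨
    Δ (- 1#) c * D (tabulate id) ∎
    where
    M : Fin (suc n) → Matrix n n
    M k i j = c (suc i) (punchIn k j)

  -- The Cauchy-Binet formula with one column more than rows: a word without repetitions omits
  -- exactly one letter p.
  expand-rectangular : ∀ {n} (c : Matrix n (suc n)) {D : Vec (Fin (suc n)) n → Carrier} → Alternating D →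
    expand c D ≈ ∑ λ p → Δ (- 1#) (λ i j → c i (punchIn p j)) * D (tabulate (punchIn p))
  expand-rectangular {zero}  c {D} alt = sym (trans (∑-suc _) (trans (+-cong (*-identityˡ _) (∑-empty _)) (+-identityʳ _)))
  expand-rectangular {suc n} c {D} alt = begin
    (∑ λ k → c zero k * expand (c ∘ suc) (D ∘ (k ∷_)))
      ≈⟨ ∑-cong (λ k → trans (*-congˡ (trans (alternating-expand-∷ (c ∘ suc) alt k)
           (expand-rectangular _ (alternating-map (alternating-∷ alt k) (punchIn k))))) (*-∑ _ _)) ⟩
    (∑ λ k → ∑ λ l → h k l)
      -- So far k is the first letter and l marks the omitted one; from here on p is the omitted
      -- letter and q the rank of the first letter among the others.
      ≈⟨ ∑-cross h ⟩
    (∑ λ p → ∑ λ q → h (punchIn p q) (cross p q))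
      ≈⟨ ∑∑-cong (λ p q → trans (*-congˡ (*-cong
           (Δ-cong (- 1#) λ i j → reflexive (≡.cong (c (suc i)) (punchIn-punchIn p q j)))
           (trans (reflexive (≡.cong (λ f → D (punchIn p q ∷ f)) (front p q)))
                  (alternating-move alt q (punchIn p)))))
           (solve 4 (λ c m e d → c :* (m :* (e :* d)) := d :* (e :* (c :* m))) refl _ _ _ _)) ⟩
    (∑ λ p → ∑ λ q → D (tabulate (punchIn p)) * ((- 1#) ^ toℕ q * (c zero (punchIn p q) * M p q)))
      ≈⟨ ∑-cong (λ p → trans (*-comm _ _) (*-∑ _ _)) ⟨
    (∑ λ p → Δ (- 1#) (λ i j → c i (punchIn p j)) * D (tabulate (punchIn p))) ∎
    where
    M : Fin (suc (suc n)) → Fin (suc n) → Carrier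
    M k l = Δ (- 1#) λ i j → c (suc i) (punchIn k (punchIn l j))
    h : Fin (suc (suc n)) → Fin (suc n) → Carrier
    h k l = c zero k * (M k l * D (k ∷ map (punchIn k) (tabulate (punchIn l))))
    front : ∀ p q → map (punchIn (punchIn p q)) (tabulate (punchIn (cross p q))) ≡ tabulate (punchIn p ∘ punchIn q)
    front p q = ≡.trans (≡.sym (tabulate-∘ _ _)) (tabulate-cong (punchIn-punchIn p q))

  -- The product of a permanent and a determinant

  1^n≈1 : ∀ n → 1# ^ n ≈ 1#
  1^n≈1 zero    = refl
  1^n≈1 (suc n) = trans (*-identityˡ _) (1^n≈1 n)

  per-column : ∀ {n} (B : Matrix (suc n) (suc n)) j →
    Δ 1# B ≈ ∑ λ k → B k j * Δ 1# λ i j′ → B (punchIn k i) (punchIn j j′)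
  per-column B j = begin
    Δ 1# B
      ≈⟨ Δ-transpose 1# B ⟨
    Δ 1# (λ i j → B j i)
      ≈⟨ Δ-row (*-identityˡ 1#) (λ i j → B j i) j ⟩
    (∑ λ k → 1# ^ toℕ j * 1# ^ toℕ k * (B k j * Δ 1# λ i j′ → B (punchIn k j′) (punchIn j i)))
      ≈⟨ ∑-cong (λ k → trans (*-cong (trans (*-cong (1^n≈1 (toℕ j)) (1^n≈1 (toℕ k))) (*-identityˡ 1#))
           (*-congˡ (Δ-transpose 1# λ i j′ → B (punchIn k i) (punchIn j j′)))) (*-identityˡ _)) ⟩
    (∑ λ k → B k j * Δ 1# λ i j′ → B (punchIn k i) (punchIn j j′)) ∎

  -- A sum over the orderings of `xs`; choosing the first entry and then ordering the others matches
  -- one step of a Laplace expansion.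
  arrange : ∀ {a} {A : Set a} {n} → Vector A n → (Vec A n → Carrier) → Carrier
  arrange {n = zero}  xs F = F []
  arrange {n = suc n} xs F = ∑ λ k → arrange (λ i → xs (punchIn k i)) (F ∘ (xs k ∷_))

  module _ {a : Level} {A : Set a} where

    arrange-cong : ∀ {n} (xs : Vector A n) {F G : Vec A n → Carrier} →
      (∀ ys → F ys ≈ G ys) → arrange xs F ≈ arrange xs G
    arrange-cong {zero}  xs F≈G = F≈G []
    arrange-cong {suc n} xs F≈G = ∑-cong λ k → arrange-cong _ (F≈G ∘ (xs k ∷_))

    arrange-* : ∀ {n} (xs : Vector A n) x (F : Vec A n → Carrier) →
      arrange xs (λ ys → x * F ys) ≈ x * arrange xs F
    arrange-* {zero}  xs x F = refl
    arrange-* {suc n} xs x F = trans (∑-cong λ k → arrange-* {n} _ x (F ∘ (xs k ∷_))) (sym (*-∑ _ _))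

    arrange-∑ : ∀ {n p} (xs : Vector A n) (F : Fin p → Vec A n → Carrier) →
      arrange xs (λ ys → ∑ λ j → F j ys) ≈ ∑ λ j → arrange xs (F j)
    arrange-∑ {zero}  xs F = refl
    arrange-∑ {suc n} xs F = trans (∑-cong λ k → arrange-∑ _ (λ j → F j ∘ (xs k ∷_))) (∑-comm _)

    arrange-∏ : ∀ {n} (xs : Vector A n) (w : Fin n → A → Carrier) →
      arrange xs (λ ys → ∏ λ i → w i (lookup ys i)) ≈ Δ 1# λ i j → w i (xs j)
    arrange-∏ {zero}  xs w = ∏-empty _
    arrange-∏ {suc n} xs w = ∑-cong λ k → begin
      arrange (λ i → xs (punchIn k i)) (λ ys → ∏ λ i → w i (lookup (xs k ∷ ys) i))
        ≈⟨ arrange-cong {n} _ (λ ys → ∏-suc _) ⟩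
      arrange (λ i → xs (punchIn k i)) (λ ys → w zero (xs k) * ∏ λ i → w (suc i) (lookup ys i))
        ≈⟨ arrange-* {n} _ _ (λ ys → ∏ λ i → w (suc i) (lookup ys i)) ⟩
      w zero (xs k) * arrange (λ i → xs (punchIn k i)) (λ ys → ∏ λ i → w (suc i) (lookup ys i))
        ≈⟨ *-congˡ (arrange-∏ _ (w ∘ suc)) ⟩
      w zero (xs k) * Δ 1# (λ i j → w (suc i) (xs (punchIn k j)))
        ≈⟨ trans (*-congʳ (1^n≈1 (toℕ k))) (*-identityˡ _) ⟨
      1# ^ toℕ k * (w zero (xs k) * Δ 1# (λ i j → w (suc i) (xs (punchIn k j)))) ∎

    -- `Δ ε B` is expanded along row 0 and, in its j-th term, the permanent along column j, so that
    -- row k of the permanent meets row 0 of `B` in column j. Both minors then have the same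
    -- columns, and the recursion applies to them.
    per*Δ : ∀ ε {n} (xs : Vector A n) (r : A → Vector Carrier n) (B : Matrix n n) →
      Δ 1# (r ∘ xs) * Δ ε B ≈ arrange xs λ ys → Δ ε λ i j → r (lookup ys i) j * B i j
    per*Δ ε {zero}  xs r B = *-identityˡ 1#
    per*Δ ε {suc n} xs r B = begin
      Δ 1# (r ∘ xs) * (∑ λ j → ε ^ toℕ j * (B zero j * M j))
        ≈⟨ *-∑ _ _ ⟩
      (∑ λ j → Δ 1# (r ∘ xs) * (ε ^ toℕ j * (B zero j * M j)))
        ≈⟨ ∑-cong (λ j → trans (*-congʳ (per-column (r ∘ xs) j)) (trans (*-comm _ _) (*-∑ _ _))) ⟩
      (∑ λ j → ∑ λ k → ε ^ toℕ j * (B zero j * M j) * (r (xs k) j * P k j))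
        ≈⟨ ∑-comm _ ⟩
      (∑ λ k → ∑ λ j → ε ^ toℕ j * (B zero j * M j) * (r (xs k) j * P k j))
        ≈⟨ ∑∑-cong (λ k j → trans
             (solve 5 (λ e b m x p → e :* (b :* m) :* (x :* p) := e :* (x :* b :* (p :* m))) refl _ _ _ _ _)
             (*-congˡ (*-congˡ (per*Δ ε (λ i → xs (punchIn k i)) (λ x j′ → r x (punchIn j j′)) _)))) ⟩
      (∑ λ k → ∑ λ j → ε ^ toℕ j * (r (xs k) j * B zero j * arrange (λ i → xs (punchIn k i)) λ ys →
        Δ ε λ i j′ → r (lookup ys i) (punchIn j j′) * B (suc i) (punchIn j j′)))
        ≈⟨ ∑-cong (λ k → trans
             (arrange-∑ (λ i → xs (punchIn k i)) (λ j ys → ε ^ toℕ j * (r (xs k) j * B zero j * N j ys)))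
             (∑-cong λ j → trans (arrange-* {n} _ _ _) (*-congˡ (arrange-* {n} _ _ (N j))))) ⟨
      arrange xs (λ ys → Δ ε λ i j → r (lookup ys i) j * B i j) ∎
      where
      M : Fin (suc n) → Carrier
      M j = Δ ε λ i j′ → B (suc i) (punchIn j j′)
      N : Fin (suc n) → Vec A n → Carrier
      N j ys = Δ ε λ i j′ → r (lookup ys i) (punchIn j j′) * B (suc i) (punchIn j j′)
      P : Fin (suc n) → Fin (suc n) → Carrier
      P k j = Δ 1# λ i j′ → r (xs (punchIn k i)) (punchIn j j′)

  -- Words without descents and permanents of block matrices

  -- A word without descents is some `step k`: after a leading 1 only ones follow, and after a
  -- leading 0 the rest is again free of descents.
  expand-descent : ∀ {n} (c : Matrix n 2) (D : Vec (Fin 2) n → Carrier) → (∀ f → Descent f → D f ≈ 0#) →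
    expand c D ≈ ∑ λ k → ∏ (λ i → c i (step k i)) * D (tabulate (step k))
  expand-descent {zero}  c D D≈0 = sym (trans (∑-suc _)
    (trans (+-cong (trans (*-congʳ (∏-empty _)) (*-identityˡ _)) (∑-empty _)) (+-identityʳ _)))
  expand-descent {suc n} c D D≈0 = begin
    expand c D
      ≈⟨ trans (∑-suc _) (+-congˡ (trans (∑-suc _) (trans (+-congˡ (∑-empty _)) (+-identityʳ _)))) ⟩
    c zero 0F * expand (c ∘ suc) (D ∘ (0F ∷_)) + c zero 1F * expand (c ∘ suc) (D ∘ (1F ∷_))
      -- `step zero` is the word that starts with 1, so its term has to come first.
      ≈⟨ +-comm _ _ ⟩
    c zero 1F * expand (c ∘ suc) (D ∘ (1F ∷_)) + c zero 0F * expand (c ∘ suc) (D ∘ (0F ∷_))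
      ≈⟨ +-cong (*-congˡ (trans (expand-descent (c ∘ suc) _ λ f → D≈0 (1F ∷ f) ∘ there) (trans (∑-suc _)
           (trans (+-congˡ (∑-0 λ k → trans (*-congˡ (vanish k)) (zeroʳ _))) (+-identityʳ _)))))
         (trans (*-congˡ (expand-descent (c ∘ suc) _ λ f → D≈0 (0F ∷ f) ∘ there)) (*-∑ _ _)) ⟩
    c zero 1F * (∏ (λ i → c (suc i) 1F) * D (tabulate (step zero))) +
      (∑ λ k → c zero 0F * (∏ (λ i → c (suc i) (step k i)) * D (tabulate (step (suc k)))))
      ≈⟨ trans (∑-suc _) (+-cong (fold zero) (∑-cong λ k → fold (suc k))) ⟨
    (∑ λ k → ∏ (λ i → c i (step k i)) * D (tabulate (step k))) ∎
    where
    vanish : (k : Fin n) → D (1F ∷ tabulate (step (suc k))) ≈ 0#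
    -- Matching on k makes n a successor, so that the leading 0 of `step (suc k)` appears.
    vanish zero    = D≈0 _ here
    vanish (suc k) = D≈0 _ here
    fold : ∀ k → ∏ (λ i → c i (step k i)) * D (tabulate (step k)) ≈
      c zero (step k zero) * (∏ (λ i → c (suc i) (step k (suc i))) * D (tabulate (step k)))
    fold k = trans (*-congʳ (∏-suc _)) (*-assoc _ _ _)

  δ : ∀ {n} → Fin n → Fin n → Carrier
  δ zero    zero    = 1#
  δ zero    (suc j) = 0#
  δ (suc i) zero    = 0#
  δ (suc i) (suc j) = δ i j

  ∑-δ : ∀ {n} i (f : Vector Carrier n) → (∑ λ j → δ i j * f j) ≈ f i
  ∑-δ zero    f = trans (∑-suc _) (trans (+-cong (*-identityˡ _) (∑-0 λ j → zeroˡ _)) (+-identityʳ _))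
  ∑-δ (suc i) f = trans (∑-suc _) (trans (+-cong (zeroˡ _) (∑-δ i (f ∘ suc))) (+-identityˡ _))

  ι : ℕ → Carrier
  ι n = n · 1#

  -- A 0-1 matrix whose ones fill two diagonal blocks, of sizes l × k and (n - l) × (n - k).
  stepBlock : ∀ {n} (k l : Fin (suc n)) → Matrix n n
  stepBlock k l i j = δ (step k j) (step l i)

  -- Row 0 has its ones in the columns with letter 0, and by `step-punchIn` deleting any of these
  -- leaves the block matrix for k and l.
  stepBlock-row : ∀ {n} (k l : Fin (suc n)) {x} → Δ 1# (stepBlock k l) ≈ x → ∀ j →
    1# ^ toℕ j * (stepBlock (suc k) (suc l) zero j * Δ 1# (λ i j′ → stepBlock (suc k) (suc l) (suc i) (punchIn j j′)))
      ≈ δ (step (suc k) j) 0F * x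
  stepBlock-row k l {x} eq j with step (suc k) j in s
  ... | 1F = trans (*-congˡ (zeroˡ _)) (trans (zeroʳ _) (sym (zeroˡ _)))
  ... | 0F = trans (*-cong (1^n≈1 (toℕ j)) (*-congˡ (trans (Δ-cong 1# λ i j′ →
               reflexive (≡.cong (λ t → δ t (step l i)) (step-punchIn k j s j′))) eq))) (*-identityˡ _)

  -- Rows and columns of the first block are stripped off until k or l is 0, when a row or a column
  -- of zeros appears.
  per-stepBlock-≢ : ∀ {n} (k l : Fin (suc n)) → k ≢ l → Δ 1# (stepBlock k l) ≈ 0#
  per-stepBlock-≢         zero    zero    k≢l = contradiction ≡.refl k≢l
  per-stepBlock-≢ {suc n} zero    (suc l) k≢l = Δ-zero-row 1# (stepBlock zero (suc l)) λ j → refl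
  per-stepBlock-≢ {suc n} (suc k) zero    k≢l = trans (sym (Δ-transpose 1# (stepBlock (suc k) zero)))
    (Δ-zero-row 1# (λ i j → stepBlock (suc k) zero j i) λ j → refl)
  per-stepBlock-≢ {suc n} (suc k) (suc l) k≢l = ∑-0 λ j →
    trans (stepBlock-row k l (per-stepBlock-≢ k l (k≢l ∘ ≡.cong suc)) j) (zeroʳ _)

  ∑-1 : ∀ n → ∑ {n} (λ _ → 1#) ≈ ι n
  ∑-1 zero    = ∑-empty _
  ∑-1 (suc n) = trans (∑-suc _) (+-congˡ (∑-1 n))

  ∑-step : ∀ {n} (k : Fin (suc n)) → (∑ λ j → δ (step k j) 0F) ≈ ι (toℕ k)
  ∑-step         zero    = ∑-0 λ _ → refl
  ∑-step {suc n} (suc k) = trans (∑-suc _) (+-congˡ (∑-step k))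

  per-ones : ∀ n → Δ 1# {n} (λ _ _ → 1#) ≈ ι (n !)
  per-ones zero    = sym (+-identityʳ 1#)
  per-ones (suc n) = begin
    (∑ {suc n} λ k → 1# ^ toℕ k * (1# * Δ 1# {n} (λ _ _ → 1#)))
      ≈⟨ ∑-cong (λ k → trans (*-cong (1^n≈1 (toℕ k)) (trans (*-identityˡ _) (per-ones n))) (*-comm _ _)) ⟩
    (∑ {suc n} λ k → ι (n !) * 1#)
      ≈⟨ *-∑ _ _ ⟨
    ι (n !) * ∑ {suc n} (λ k → 1#)
      ≈⟨ trans (*-comm _ _) (*-congʳ (∑-1 (suc n))) ⟩
    ι (suc n) * ι (n !)
      ≈⟨ ×1-homo-* (suc n) (n !) ⟨
    ι (suc n !) ∎

  -- Row 0 can take any column of the first block, which loses a row and a column; once that block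
  -- is empty, a single block of ones remains.
  per-stepBlock-≡ : ∀ {n} (k : Fin (suc n)) → Δ 1# (stepBlock k k) ≈ ι (toℕ k ! ℕ.* (n ∸ toℕ k) !)
  per-stepBlock-≡ {n}     zero    = trans (per-ones n) (reflexive (≡.cong ι (≡.sym (ℕ.+-identityʳ (n !)))))
  per-stepBlock-≡ {suc n} (suc k) = begin
    Δ 1# (stepBlock (suc k) (suc k))
      ≈⟨ ∑-cong (stepBlock-row k k (per-stepBlock-≡ k)) ⟩
    (∑ λ j → δ (step (suc k) j) 0F * ι (toℕ k ! ℕ.* (n ∸ toℕ k) !))
      ≈⟨ trans (∑-cong λ j → *-comm _ _) (trans (sym (*-∑ _ _)) (*-comm _ _)) ⟩
    (∑ λ j → δ (step (suc k) j) 0F) * ι (toℕ k ! ℕ.* (n ∸ toℕ k) !)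
      ≈⟨ *-congʳ (∑-step (suc k)) ⟩
    ι (suc (toℕ k)) * ι (toℕ k ! ℕ.* (n ∸ toℕ k) !)
      ≈⟨ ×1-homo-* (suc (toℕ k)) (toℕ k ! ℕ.* (n ∸ toℕ k) !) ⟨
    ι (suc (toℕ k) ℕ.* (toℕ k ! ℕ.* (n ∸ toℕ k) !))
      ≈⟨ reflexive (≡.cong ι (ℕ.*-assoc (suc (toℕ k)) (toℕ k !) _)) ⟨
    ι (suc (toℕ k) ! ℕ.* (n ∸ toℕ k) !) ∎

  -- Vandermonde determinants and Pieri's rule

  -- Homogeneous of degree N for e ≤ N: column j of `P` serves as a point in homogeneous
  -- coordinates, which avoids dividing by entries of `P`.
  monomial : ∀ {n} → Matrix 2 n → ℕ → ℕ → Vector Carrier n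
  monomial P N e j = P 1F j ^ e * P 0F j ^ (N ∸ e)

  monomial-shift : ∀ {n} (P : Matrix 2 n) {N e} → e ≤ N → ∀ s j →
    P s j * monomial P N e j ≈ monomial P (suc N) (toℕ s ℕ.+ e) j
  -- `e ≤ N` ensures that `suc N ∸ e` is `suc (N ∸ e)` in spite of truncation.
  monomial-shift P e≤N 0F j = trans (x∙yz≈y∙xz _ _ _)
    (*-congˡ (reflexive (≡.cong (P 0F j ^_) (≡.sym (ℕ.+-∸-assoc 1 e≤N)))))
  monomial-shift P e≤N 1F j = sym (*-assoc _ _ _)

  vandermonde : ∀ {m} → Matrix 2 (suc m) → Carrier
  vandermonde {m} P = Δ (- 1#) λ i → monomial P m (toℕ i)

  gapVandermonde : ∀ {m} → Matrix 2 (suc m) → Fin (suc (suc m)) → Carrier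
  gapVandermonde {m} P k = Δ (- 1#) λ i → monomial P (suc m) (toℕ (punchIn k i))

  -- Pieri's rule. `per*Δ` and multilinearity give a sum over orderings of `c` and over words; a
  -- descent of the word produces two equal exponents, and for the word `step k` the sum over the
  -- orderings is a permanent in `c`.
  per*vandermonde : ∀ {m} (c : Matrix (suc m) 2) (P : Matrix 2 (suc m)) →
    Δ 1# (λ i j → ∑ λ s → c i s * P s j) * vandermonde P ≈
    ∑ λ k → Δ 1# (λ i j → c j (step k i)) * gapVandermonde P k
  per*vandermonde {m} c P = begin
    Δ 1# (λ i j → ∑ λ s → c i s * P s j) * vandermonde P
      ≈⟨ per*Δ (- 1#) c (λ x j → ∑ λ s → x s * P s j) (λ i → monomial P m (toℕ i)) ⟩
    arrange c (λ ys → Δ (- 1#) λ i j → (∑ λ s → lookup ys i s * P s j) * monomial P m (toℕ i) j)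
      ≈⟨ arrange-cong c collapse ⟩
    arrange c (λ ys → ∑ λ k → D (tabulate (step k)) * ∏ λ i → lookup ys i (step k i))
      ≈⟨ trans (arrange-∑ c (λ k ys → D (tabulate (step k)) * ∏ λ i → lookup ys i (step k i)))
           (∑-cong λ k → arrange-* c (D (tabulate (step k))) (λ ys → ∏ λ i → lookup ys i (step k i))) ⟩
    (∑ λ k → D (tabulate (step k)) * arrange c (λ ys → ∏ λ i → lookup ys i (step k i)))
      ≈⟨ ∑-cong (λ k → trans (*-comm _ _) (*-cong (arrange-∏ c (λ i x → x (step k i))) (gap k))) ⟩
    (∑ λ k → Δ 1# (λ i j → c j (step k i)) * gapVandermonde P k) ∎
    where
    D : Vec (Fin 2) (suc m) → Carrier
    D f = Δ (- 1#) λ i j → P (lookup f i) j * monomial P m (toℕ i) j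
    vanish : ∀ f → Descent f → D f ≈ 0#
    vanish f d = trans
      (Δ-cong (- 1#) {n = suc m} λ i j → trans (monomial-shift P (toℕ≤pred[n] i) (lookup f i) j)
        (reflexive (≡.cong (λ e → monomial P (suc m) e j) (≡.sym (lookup-shift 0 f i)))))
      (det-alternating (monomial P (suc m)) .stutter (shift-descent 0 d))
    collapse : ∀ ys → Δ (- 1#) (λ i j → (∑ λ s → lookup ys i s * P s j) * monomial P m (toℕ i) j) ≈
      ∑ λ k → D (tabulate (step k)) * ∏ λ i → lookup ys i (step k i)
    collapse ys = begin
      Δ (- 1#) (λ i j → (∑ λ s → lookup ys i s * P s j) * monomial P m (toℕ i) j)
        ≈⟨ Δ-cong (- 1#) {n = suc m} (λ i j → trans (*-comm _ (monomial P m (toℕ i) j)) (trans (*-∑ _ (λ s → lookup ys i s * P s j))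
             (∑-cong λ s → trans (x∙yz≈y∙xz _ _ _) (*-congˡ (*-comm _ _))))) ⟩
      Δ (- 1#) (λ i j → ∑ λ s → lookup ys i s * (P s j * monomial P m (toℕ i) j))
        ≈⟨ Δ-expand (- 1#) (lookup ys) (λ i s j → P s j * monomial P m (toℕ i) j) ⟩
      expand (lookup ys) D
        ≈⟨ trans (expand-descent (lookup ys) D vanish) (∑-cong λ k → *-comm _ _) ⟩
      (∑ λ k → D (tabulate (step k)) * ∏ λ i → lookup ys i (step k i)) ∎
    gap : ∀ k → D (tabulate (step k)) ≈ gapVandermonde P k
    gap k = Δ-cong (- 1#) {n = suc m} λ i j → trans (monomial-shift P (toℕ≤pred[n] i) (lookup (tabulate (step k)) i) j)
      (reflexive (≡.cong (λ e → monomial P (suc m) e j)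
        (≡.trans (≡.cong (λ s → toℕ s ℕ.+ toℕ i) (lookup∘tabulate (step k) i)) (step+ k i))))

  -- Rows of `P` are combinations of the rows of `P` with coefficients δ. Pieri's rule then yields
  -- the permanents of `stepBlock k l`, of which only l = k survives. This is how V(P) absorbs the
  -- permanents that Pieri's rule for Q produces.
  perStep*vandermonde : ∀ {m} (P : Matrix 2 (suc m)) k →
    Δ 1# (λ i j → P (step k i) j) * vandermonde P ≈
    ι (toℕ k ! ℕ.* (suc m ∸ toℕ k) !) * gapVandermonde P k
  perStep*vandermonde {m} P k = begin
    Δ 1# (λ i j → P (step k i) j) * vandermonde P
      ≈⟨ *-congʳ (Δ-cong 1# λ i j → ∑-δ (step k i) (λ s → P s j)) ⟨
    Δ 1# (λ i j → ∑ λ s → δ (step k i) s * P s j) * vandermonde P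
      ≈⟨ per*vandermonde (λ i → δ (step k i)) P ⟩
    (∑ λ l → Δ 1# (stepBlock k l) * gapVandermonde P l)
      ≈⟨ ∑-remove k _ ⟩
    Δ 1# (stepBlock k k) * gapVandermonde P k +
      (∑ λ l → Δ 1# (stepBlock k (punchIn k l)) * gapVandermonde P (punchIn k l))
      ≈⟨ +-cong (*-congʳ (per-stepBlock-≡ k)) (∑-0 λ l →
           trans (*-congʳ (per-stepBlock-≢ k _ (punchInᵢ≢i k l ∘ ≡.sym))) (zeroˡ _)) ⟩
    ι (toℕ k ! ℕ.* (suc m ∸ toℕ k) !) * gapVandermonde P k + 0#
      ≈⟨ +-identityʳ _ ⟩
    ι (toℕ k ! ℕ.* (suc m ∸ toℕ k) !) * gapVandermonde P k ∎

  -- The Leibniz formula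

  ∑ᴸ : List Carrier → Carrier
  ∑ᴸ = List.foldr _+_ 0#

  module _ {a : Level} {A : Set a} where

    ∑ᴸ-cong : {f g : A → Carrier} → (∀ x → f x ≈ g x) → ∀ xs → ∑ᴸ (List.map f xs) ≈ ∑ᴸ (List.map g xs)
    ∑ᴸ-cong f≈g List.[]       = refl
    ∑ᴸ-cong f≈g (x List.∷ xs) = +-cong (f≈g x) (∑ᴸ-cong f≈g xs)

    ∑ᴸ-* : ∀ y (f : A → Carrier) xs → ∑ᴸ (List.map (λ x → y * f x) xs) ≈ y * ∑ᴸ (List.map f xs)
    ∑ᴸ-* y f List.[]       = sym (zeroʳ y)
    ∑ᴸ-* y f (x List.∷ xs) = trans (+-congˡ (∑ᴸ-* y f xs)) (sym (distribˡ y _ _))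

    ∑ᴸ-tabulate : ∀ {n} (f : A → Carrier) (g : Fin n → A) →
      ∑ᴸ (List.map f (List.tabulate g)) ≈ ∑ λ i → f (g i)
    ∑ᴸ-tabulate {zero}  f g = sym (∑-empty _)
    ∑ᴸ-tabulate {suc n} f g = trans (+-congˡ (∑ᴸ-tabulate f (g ∘ suc))) (sym (∑-suc _))

  ∑ᴸ-++ : ∀ xs ys → ∑ᴸ (xs List.++ ys) ≈ ∑ᴸ xs + ∑ᴸ ys
  ∑ᴸ-++ List.[]       ys = sym (+-identityˡ _)
  ∑ᴸ-++ (x List.∷ xs) ys = trans (+-congˡ (∑ᴸ-++ xs ys)) (sym (+-assoc x _ _))

  ∑ᴸ-cartesianProductWith : ∀ {a b d} {A : Set a} {B : Set b} {D : Set d} (h : D → Carrier) (f : A → B → D) xs ys →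
    ∑ᴸ (List.map h (List.cartesianProductWith f xs ys)) ≈
    ∑ᴸ (List.map (λ x → ∑ᴸ (List.map (λ y → h (f x y)) ys)) xs)
  ∑ᴸ-cartesianProductWith h f List.[]       ys = refl
  ∑ᴸ-cartesianProductWith h f (x List.∷ xs) ys = begin
    ∑ᴸ (List.map h (List.map (f x) ys List.++ List.cartesianProductWith f xs ys))
      ≡⟨ ≡.cong ∑ᴸ (List.map-++ h (List.map (f x) ys) _) ⟩
    ∑ᴸ (List.map h (List.map (f x) ys) List.++ List.map h (List.cartesianProductWith f xs ys))
      ≈⟨ ∑ᴸ-++ (List.map h (List.map (f x) ys)) _ ⟩
    ∑ᴸ (List.map h (List.map (f x) ys)) + ∑ᴸ (List.map h (List.cartesianProductWith f xs ys))
      ≈⟨ +-cong (reflexive (≡.cong ∑ᴸ (≡.sym (List.map-∘ ys)))) (∑ᴸ-cartesianProductWith h f xs ys) ⟩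
    ∑ᴸ (List.map (λ y → h (f x y)) ys) + ∑ᴸ (List.map (λ x → ∑ᴸ (List.map (λ y → h (f x y)) ys)) xs) ∎

  -- `permutations` chooses the image k of 0 first, which is the choice of a column for row 0; by
  -- `inversions-insert` it contributes the factor ε ^ k.
  Leibniz : ∀ ε {n} (B : Matrix n n) →
    sumₛ (λ σ → ε ^ inversions σ * product λ i → B i (σ ⟨$⟩ʳ i)) ≈ Δ ε B
  Leibniz ε {zero}  B = trans (+-identityʳ _) (*-identityˡ 1#)
  Leibniz ε {suc n} B = begin
    ∑ᴸ (List.map h (permutations (suc n)))
      ≈⟨ ∑ᴸ-cartesianProductWith h (insert zero) (List.allFin (suc n)) (permutations n) ⟩
    ∑ᴸ (List.map (λ k → ∑ᴸ (List.map (λ π → h (insert zero k π)) (permutations n))) (List.allFin (suc n)))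
      ≈⟨ ∑ᴸ-tabulate _ id ⟩
    (∑ λ k → ∑ᴸ (List.map (λ π → h (insert zero k π)) (permutations n)))
      ≈⟨ ∑-cong (λ k → trans (∑ᴸ-cong (split k) (permutations n)) (trans (∑ᴸ-* (ε ^ toℕ k) _ (permutations n))
           (*-congˡ (trans (∑ᴸ-* (B zero k) _ (permutations n)) (*-congˡ (Leibniz ε λ i j → B (suc i) (punchIn k j))))))) ⟩
    Δ ε B ∎
    where
    h : Permutation′ (suc n) → Carrier
    h σ = ε ^ inversions σ * product λ i → B i (σ ⟨$⟩ʳ i)
    split : ∀ k π → h (insert zero k π) ≈
      ε ^ toℕ k * (B zero k * (ε ^ inversions π * product λ i → B (suc i) (punchIn k (π ⟨$⟩ʳ i))))
    split k π = begin
      h (insert zero k π)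
        ≈⟨ *-congʳ (trans (reflexive (≡.cong (ε ^_) (inversions-insert k π))) (^-homo-* ε (toℕ k) (inversions π))) ⟩
      ε ^ toℕ k * ε ^ inversions π * (B zero k * product λ i → B (suc i) (punchIn k (π ⟨$⟩ʳ i)))
        ≈⟨ solve 4 (λ e v b p → e :* v :* (b :* p) := e :* (b :* (v :* p))) refl _ _ _ _ ⟩
      ε ^ toℕ k * (B zero k * (ε ^ inversions π * product λ i → B (suc i) (punchIn k (π ⟨$⟩ʳ i)))) ∎

  det≈Δ : ∀ {n} (B : Matrix n n) → det B ≈ Δ (- 1#) B
  det≈Δ = Leibniz (- 1#)

  per≈Δ : ∀ {n} (B : Matrix n n) → per B ≈ Δ 1# B
  per≈Δ {n} B = trans
    (∑ᴸ-cong (λ σ → sym (trans (*-congʳ (1^n≈1 (inversions σ))) (*-identityˡ _))) (permutations n))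
    (Leibniz 1# B)

  -- Matrices that factor through two rows

  ι-∏ : ∀ {n} (f : Fin n → ℕ) → ι (ℕ∏.sum f) ≈ ∏ λ i → ι (f i)
  ι-∏ {zero}  f = trans (+-identityʳ 1#) (sym (∏-empty _))
  ι-∏ {suc n} f = trans (×1-homo-* (f zero) _) (trans (*-congˡ (ι-∏ (f ∘ suc))) (sym (∏-suc _)))

  ·≈ι* : ∀ n x → n · x ≈ ι n * x
  ·≈ι* zero    x = sym (zeroˡ x)
  ·≈ι* (suc n) x = trans (+-cong (sym (*-identityˡ x)) (·≈ι* n x)) (sym (distribʳ x 1# (ι n)))

  factor : ∀ {n} → Matrix 2 n → Matrix 2 n → Matrix n n
  factor P Q i j = ∑ λ s → P s i * Q s j

  factor^ : ∀ {n} (P Q : Matrix 2 n) N i j → factor P Q i j ^ N ≈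
    ∑ λ (k : Fin (suc N)) → ι (binomials N k) * monomial P N (toℕ k) i * monomial Q N (toℕ k) j
  factor^ P Q N i j = begin
    factor P Q i j ^ N
      -- The summands are exchanged because the binomial theorem gives the exponent k to the first
      -- of them and `monomial` gives it to row `1F`.
      ≈⟨ ^-congˡ N (trans (∑-suc _) (trans (+-congˡ (trans (∑-suc _) (trans (+-congˡ (∑-empty _)) (+-identityʳ _)))) (+-comm _ _))) ⟩
    (P 1F i * Q 1F j + P 0F i * Q 0F j) ^ N
      ≈⟨ binomial-theorem N _ _ ⟩
    sum (λ (k : Fin (suc N)) → binomials N k · ((P 1F i * Q 1F j) ^ toℕ k * (P 0F i * Q 0F j) ^ (N ∸ toℕ k)))
      ≈⟨ ∑≈sum _ ⟨
    (∑ λ (k : Fin (suc N)) → binomials N k · ((P 1F i * Q 1F j) ^ toℕ k * (P 0F i * Q 0F j) ^ (N ∸ toℕ k)))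
      ≈⟨ ∑-cong (λ k → trans (·≈ι* (binomials N k) _)
           (trans (*-congˡ (*-cong (^-distrib-* _ _ (toℕ k)) (^-distrib-* _ _ (N ∸ toℕ k))))
             (solve 5 (λ b x y z w → b :* (x :* y :* (z :* w)) := b :* (x :* z) :* (y :* w)) refl _ _ _ _ _))) ⟩
    (∑ λ k → ι (binomials N k) * monomial P N (toℕ k) i * monomial Q N (toℕ k) j) ∎

  module _ {m : ℕ} (P Q : Matrix 2 (suc m)) where

    private
      n = suc m

      coeff : ∀ N → Matrix n (suc N)
      coeff N i k = ι (binomials N k) * monomial P N (toℕ k) i

      D : ∀ N → Vec (Fin (suc N)) n → Carrier
      D N = λ f → Δ (- 1#) (select (monomial Q N ∘ toℕ) f)

      det-factor^ : ∀ N → Δ (- 1#) (factor P Q ^∘ N) ≈ expand (coeff N) (D N)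
      det-factor^ N = trans (Δ-cong (- 1#) {n} (factor^ P Q N))
        (Δ-expand (- 1#) (coeff N) (λ i k → monomial Q N (toℕ k)))

    -- There are as many monomials of degree m as rows, so `expand-square` applies; the binomial
    -- coefficients scale the columns of the factor in `P`.
    det-factor^pred : Δ (- 1#) (factor P Q ^∘ m) ≈
      ι (ℕ∏.sum (binomials m)) * vandermonde P * vandermonde Q
    det-factor^pred = begin
      Δ (- 1#) (factor P Q ^∘ m)
        ≈⟨ trans (det-factor^ m) (expand-square (coeff m) (det-alternating _)) ⟩
      Δ (- 1#) (coeff m) * D m (tabulate id)
        ≈⟨ *-cong (trans (Δ-scale (- 1#) (λ k → ι (binomials m k)) (λ i k → monomial P m (toℕ k) i))
             (*-cong (sym (ι-∏ (binomials m))) (Δ-transpose (- 1#) (λ k → monomial P m (toℕ k)))))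
           (Δ-cong (- 1#) {n} λ i j → reflexive (≡.cong (λ k → monomial Q m (toℕ k) j) (lookup∘tabulate id i))) ⟩
      ι (ℕ∏.sum (binomials m)) * vandermonde P * vandermonde Q ∎

    -- Degree n has one monomial more than there are rows, so Cauchy-Binet sums over the omitted
    -- one.
    det-factor^suc : Δ (- 1#) (factor P Q ^∘ n) ≈
      ∑ λ k → ι (ℕ∏.sum λ l → binomials n (punchIn k l)) * (gapVandermonde P k * gapVandermonde Q k)
    det-factor^suc = begin
      Δ (- 1#) (factor P Q ^∘ n)
        ≈⟨ trans (det-factor^ n) (expand-rectangular (coeff n) (det-alternating _)) ⟩
      (∑ λ k → Δ (- 1#) (λ i l → coeff n i (punchIn k l)) * D n (tabulate (punchIn k)))
        ≈⟨ ∑-cong (λ k → trans (*-cong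
             (trans (Δ-scale (- 1#) (λ l → ι (binomials n (punchIn k l))) (λ i l → monomial P n (toℕ (punchIn k l)) i))
               (*-cong (sym (ι-∏ λ l → binomials n (punchIn k l)))
                       (Δ-transpose (- 1#) (λ l → monomial P n (toℕ (punchIn k l))))))
             (Δ-cong (- 1#) {n} λ i j → reflexive (≡.cong (λ l → monomial Q n (toℕ l) j) (lookup∘tabulate (punchIn k) i))))
             (*-assoc _ _ _)) ⟩
      (∑ λ k → ι (ℕ∏.sum λ l → binomials n (punchIn k l)) * (gapVandermonde P k * gapVandermonde Q k)) ∎

    -- Pieri's rule is used twice: for `Q` with the columns of `P` as coefficients, and then through
    -- `perStep*vandermonde`, where V(P) multiplies the resulting permanents in `P`.
    per-factor : vandermonde P * vandermonde Q * Δ 1# (factor P Q) ≈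
      ∑ λ k → ι (toℕ k ! ℕ.* (n ∸ toℕ k) !) * (gapVandermonde P k * gapVandermonde Q k)
    per-factor = begin
      vandermonde P * vandermonde Q * Δ 1# (factor P Q)
        ≈⟨ trans (*-assoc _ _ _) (*-congˡ (trans (*-comm _ _) (per*vandermonde (λ i s → P s i) Q))) ⟩
      vandermonde P * (∑ λ k → Δ 1# (λ i j → P (step k i) j) * gapVandermonde Q k)
        ≈⟨ *-∑ _ _ ⟩
      (∑ λ k → vandermonde P * (Δ 1# (λ i j → P (step k i) j) * gapVandermonde Q k))
        ≈⟨ ∑-cong (λ k → trans (sym (*-assoc _ _ _)) (trans
             (*-congʳ (trans (*-comm _ _) (perStep*vandermonde P k))) (*-assoc _ _ _))) ⟩
      (∑ λ k → ι (toℕ k ! ℕ.* (n ∸ toℕ k) !) * (gapVandermonde P k * gapVandermonde Q k)) ∎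

    -- The two sums over k are compared term by term, so V(P) V(Q), which may be 0, is never
    -- cancelled.
    det-factor : ι ((n !) ℕ.^ 2) * Δ (- 1#) (factor P Q ^∘ n) ≈
      ι (n ℕ.^ n) * (Δ (- 1#) (factor P Q ^∘ m) * Δ 1# (factor P Q))
    det-factor = begin
      ι ((n !) ℕ.^ 2) * Δ (- 1#) (factor P Q ^∘ n)
        ≈⟨ trans (*-congˡ det-factor^suc) (*-∑ _ _) ⟩
      (∑ λ k → ι ((n !) ℕ.^ 2) * (ι (ℕ∏.sum λ l → binomials n (punchIn k l)) * (gapVandermonde P k * gapVandermonde Q k)))
        ≈⟨ ∑-cong (λ k → trans (sym (*-assoc _ _ _)) (trans (*-congʳ (coefficient k)) (trans (*-assoc _ _ _) (*-congˡ (*-assoc _ _ _))))) ⟩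
      (∑ λ k → ι (n ℕ.^ n) * (ι (ℕ∏.sum (binomials m)) *
        (ι (toℕ k ! ℕ.* (n ∸ toℕ k) !) * (gapVandermonde P k * gapVandermonde Q k))))
        ≈⟨ **-∑ _ _ _ ⟨
      ι (n ℕ.^ n) * (ι (ℕ∏.sum (binomials m)) *
        ∑ λ k → ι (toℕ k ! ℕ.* (n ∸ toℕ k) !) * (gapVandermonde P k * gapVandermonde Q k))
        ≈⟨ *-congˡ (*-congˡ per-factor) ⟨
      ι (n ℕ.^ n) * (ι (ℕ∏.sum (binomials m)) * (vandermonde P * vandermonde Q * Δ 1# (factor P Q)))
        ≈⟨ *-congˡ (trans (*-congʳ det-factor^pred) (trans (*-congʳ (*-assoc _ _ _)) (*-assoc _ _ _))) ⟨
      ι (n ℕ.^ n) * (Δ (- 1#) (factor P Q ^∘ m) * Δ 1# (factor P Q)) ∎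
      where
      coefficient : ∀ k → ι ((n !) ℕ.^ 2) * ι (ℕ∏.sum λ l → binomials n (punchIn k l)) ≈
        ι (n ℕ.^ n) * (ι (ℕ∏.sum (binomials m)) * ι (toℕ k ! ℕ.* (n ∸ toℕ k) !))
      coefficient k = begin
        ι ((n !) ℕ.^ 2) * ι (ℕ∏.sum λ l → binomials n (punchIn k l))
          ≈⟨ ×1-homo-* ((n !) ℕ.^ 2) _ ⟨
        ι ((n !) ℕ.^ 2 ℕ.* ℕ∏.sum λ l → binomials n (punchIn k l))
          ≡⟨ ≡.cong ι (∏-binomials-punchIn m k) ⟩
        ι (n ℕ.^ n ℕ.* (ℕ∏.sum (binomials m) ℕ.* (toℕ k ! ℕ.* (n ∸ toℕ k) !)))
          ≈⟨ trans (×1-homo-* (n ℕ.^ n) _) (*-congˡ (×1-homo-* (ℕ∏.sum (binomials m)) _)) ⟩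
        ι (n ℕ.^ n) * (ι (ℕ∏.sum (binomials m)) * ι (toℕ k ! ℕ.* (n ∸ toℕ k) !)) ∎

  -- Matrices of rank 2

  -- The rows of `P` are the basis vectors of the column space, and `Q` holds the coordinates of the
  -- columns of `X`.
  rank-factor : ∀ {m n r} (X : Matrix m n) → HasRank X r →
    ∃[ P ] ∃[ Q ] (∀ i j → X i j ≈ ∑ λ (s : Fin r) → P s i * Q s j)
  rank-factor X (v , basis) =
    v , (λ s j → proj₁ (in-span j) s) , λ i j → begin
      X i j                                     ≈⟨ proj₂ (in-span j) i ⟩
      sum (λ s → proj₁ (in-span j) s * v s i)   ≈⟨ ∑≈sum _ ⟨
      (∑ λ s → proj₁ (in-span j) s * v s i)     ≈⟨ ∑-cong (λ s → *-comm _ _) ⟩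
      (∑ λ s → v s i * proj₁ (in-span j) s)     ∎
    where
    in-span : ∀ j → column X j ∈span v
    in-span j = IsColumnSpaceBasis.spanning basis (column X j)
      -- Unit coefficients place column j in the span of the columns.
      (δ j , λ i → sym (trans (sym (∑≈sum _)) (∑-δ j (X i))))

  det-rank₂ : ∀ {m} → let n = suc m in (X : Matrix n n) → HasRank X 2 →
    ((n !) ℕ.^ 2) · det (X ^∘ n) ≈ (n ℕ.^ n) · (det (X ^∘ m) * per X)
  det-rank₂ {m} X rank with P , Q , X≈PQ ← rank-factor X rank = begin
    ((n !) ℕ.^ 2) · det (X ^∘ n)
      ≈⟨ trans (·≈ι* ((n !) ℕ.^ 2) _) (*-congˡ (power n)) ⟩
    ι ((n !) ℕ.^ 2) * Δ (- 1#) (factor P Q ^∘ n)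
      ≈⟨ det-factor P Q ⟩
    ι (n ℕ.^ n) * (Δ (- 1#) (factor P Q ^∘ m) * Δ 1# (factor P Q))
      ≈⟨ trans (·≈ι* (n ℕ.^ n) _) (*-congˡ (*-cong (power m) (trans (per≈Δ X) (Δ-cong 1# {n} X≈PQ)))) ⟨
    (n ℕ.^ n) · (det (X ^∘ m) * per X) ∎
    where
    n = suc m
    power : ∀ N → det (X ^∘ N) ≈ Δ (- 1#) (factor P Q ^∘ N)
    power N = trans (det≈Δ (X ^∘ N)) (Δ-cong (- 1#) {n} λ i j → ^-congˡ N (X≈PQ i j))

open import Defs

theorem9 : (n : ℕ) → .{{_ : NonZero n}} → (X : Matrix n n) → HasRank X 2 →
    ((n !) ^ℕ 2) · det (X ^∘ n) ≃ (n ^ℕ n) · (det (X ^∘ (n ∸ 1)) *ᴿ per X)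
theorem9 zero    X rank = contradiction ≡.refl (ℕ.≢-nonZero⁻¹ 0)
theorem9 (suc m) X rank = RankTwo.det-rank₂ ℝ-commutativeRing X rank
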